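{- Let $G$ be a graph of order $n$ with minimum degree $\delta(G) \ge 4$. Then $\gamma_{\rm pr}(G) \le \frac{10}{17}n$ (in particular $\gamma_{\rm pr}(G) < 0.5883\, n$).
   Context: All graphs are finite and simple. A set $S \subseteq V(G)$ is a paired dominating set of $G$ if every vertex of $G$ not in $S$ is adjacent to a vertex in $S$ and the induced subgraph $G[S]$ contains a perfect matching (not necessarily induced). The paired domination number $\gamma_{\rm pr}(G)$ is the minimum cardinality of a paired dominating set of $G$. -}

module Defs where

open import Data.Fin using (Fin)
open import Data.Fin.Subset using (Subset; _∈_; _∉_; ∣_∣)
open import Data.Nat using (ℕ; suc; _⊓_; _≤_; NonZero)
open import Data.Product using (∃; ∃-syntax; ∃!; _×_; proj₁)
open import Data.Vec using (tabulate; foldr₁)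
open import Level using (0ℓ)
open import Relation.Binary using (Rel; _⇒_; Symmetric; Irreflexive; Decidable)
open import Relation.Binary.PropositionalEquality using (_≡_; cong)
open import Relation.Nullary using (does)

-- Adjacency is decidable, as for any concretely given finite graph.
-- A graph of order n is a Graph (Fin n).
record Graph (V : Set) : Set₁ where
  field
    Adj    : Rel V 0ℓ
    sym    : Symmetric Adj
    irrefl : Irreflexive _≡_ Adj
    adj?   : Decidable Adj

open Graph public using (Adj)

module _ {n : ℕ} (G : Graph (Fin n)) where

  neighbourhood : Fin n → Subset n
  neighbourhood v = tabulate λ u → does (Graph.adj? G v u)

  degree : Fin n → ℕ
  degree v = ∣ neighbourhood v ∣

-- The minimum over the vertices, so defined only for positive order.
minDegree : ∀ {n} .{{_ : NonZero n}} → Graph (Fin n) → ℕ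
minDegree {n = suc _} G = foldr₁ _⊓_ (tabulate (degree G))

-- The vertices of G [ S ] are those of S: membership proofs for Subset are
-- unique (Data.Vec.Properties.[]=-irrelevant), so no vertex is repeated.
_[_] : ∀ {n} → Graph (Fin n) → (S : Subset n) → Graph (∃ (_∈ S))
G [ S ] = record
  { Adj    = λ u v → Adj G (proj₁ u) (proj₁ v)
  ; sym    = Graph.sym G
  ; irrefl = λ u≡v → Graph.irrefl G (cong proj₁ u≡v)
  ; adj?   = λ u v → Graph.adj? G (proj₁ u) (proj₁ v)
  }

-- A set of edges, given as a symmetric subrelation of adjacency, such that
-- every vertex lies on exactly one of them.
record PerfectMatching {V : Set} (G : Graph V) : Set₁ where
  field
    Matched  : Rel V 0ℓ
    sym      : Symmetric Matched
    edges    : Matched ⇒ Adj G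
    saturate : ∀ v → ∃! _≡_ (Matched v)

record IsPairedDominating {n : ℕ} (G : Graph (Fin n)) (S : Subset n) : Set₁ where
  field
    dominates : ∀ v → v ∉ S → ∃[ u ] (u ∈ S × Adj G v u)
    matching  : PerfectMatching (G [ S ])

-- k is γ_pr(G).  A relation rather than a function, since a graph with an
-- isolated vertex has no paired dominating set.
record IsPairedDominationNumber {n : ℕ} (G : Graph (Fin n)) (k : ℕ) : Set₁ where
  field
    attained : ∃[ S ] (IsPairedDominating G S × ∣ S ∣ ≡ k)
    minimal  : ∀ S → IsPairedDominating G S → k ≤ ∣ S ∣

{-# OPTIONS --safe #-}
-- A list of k edges ab whose closed neighbourhoods N[a] ∪ N[b] cover the graph yields a paired
-- dominating set of size at most 2k: add the edges one at a time, and if only b is new, match it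
-- with a new neighbour, or drop it when all its neighbours are already in the set.
--
-- To cover the graph by 5n/17 edges, choose them greedily with respect to a potential: a white
-- (not yet dominated) vertex weighs 35, a blue (dominated) vertex with k white neighbours weighs
-- 0, 21, 23.8, 26.8 or 28.8 for k = 0, 1, 2, 3 and k ≥ 4, and an edge has to free 119.  Take
-- an edge dominating the largest number g of white vertices, joining two white vertices if
-- possible.  If it contains a and x ∈ N(a) keeps k white neighbours, then ax dominates at least
-- k + |N[a] ∩ U| ≤ g white vertices; this bound on k suffices when g ≥ 7, and for g ≤ 6 it
-- suffices together with what the blue neighbours of the removed vertices lose, because every
-- vertex has degree at least 4.
--
-- The exception is when the white vertices are independent and every blue vertex has at most
-- two white neighbours: these blue vertices are then the edges of a multigraph on the white
-- vertices.  There a second potential, convex in the number of private blue neighbours of a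
-- white vertex, makes the greedy choice (near private neighbours, or across parallel edges) pay.
module Submission where

open import Defs

module PairedDomination where

  open import Data.Bool using (Bool; true; false; _∧_; _∨_; not; if_then_else_)
  import Data.Bool.Properties as Bool
  open import Data.Empty using (⊥-elim)
  open import Data.Fin using (Fin; zero; suc; _≟_)
  open import Data.Fin.Properties using (all?; any?)
  open import Data.Fin.Subset using (Subset; ∣_∣; _∈_; _∉_)
  open import Data.Fin.Subset.Properties using (_∈?_; anySubset?)
  open import Data.List using (List; []; _∷_; length)
  open import Data.List.Relation.Unary.All using (All; []; _∷_)
  open import Data.List.Relation.Unary.Any using (Any; here; there)
  open import Data.Nat
    using (ℕ; zero; suc; _+_; _*_; _∸_; _⊔_; _⊓_; _≤_; _<_; _≤?_; z≤n; s≤s; NonZero; ≤′-refl; ≤′-step; _≤′_)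
  open import Data.Nat.Properties renaming (_≟_ to _≟ℕ_)
  open import Algebra.Properties.Semiring.Sum +-*-semiring
    using (sum; ∑-distrib-+; ∑-comm; sum-cong-≗; *-distribˡ-sum)
  open import Data.Nat.Tactic.RingSolver using (solve-∀)
  open import Data.Product using (∃; ∃-syntax; _×_; _,_; proj₁; proj₂)
  open import Data.Sum as Sum using (_⊎_; inj₁; inj₂; [_,_]′)
  open import Data.Unit using (tt)
  open import Data.Vec using (Vec; []; _∷_; tabulate; lookup; foldr₁)
  open import Data.Vec.Properties using ([]=⇒lookup; lookup⇒[]=; lookup∘tabulate)
  open import Data.Vec.Properties.WithK using ([]=-irrelevant)
  open import Function using (_∘_; id)
  open import Relation.Binary.PropositionalEquality
  open import Relation.Nullary using (¬_; ¬?; Dec; yes; no; does)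
  open import Relation.Nullary.Decidable
    using (True; dec-true; dec-false; map′; toWitness; _×-dec_; _→-dec_; _⊎-dec_)

  -- Finite sums and counting with Boolean indicators

  ⟦_⟧ : Bool → ℕ
  ⟦ true ⟧ = 1
  ⟦ false ⟧ = 0

  ⟦⟧≤1 : ∀ b → ⟦ b ⟧ ≤ 1
  ⟦⟧≤1 true = ≤-refl
  ⟦⟧≤1 false = z≤n

  abstract
    ∑ : ∀ {n} → (Fin n → ℕ) → ℕ
    ∑ = sum

    ∑-empty : (f : Fin 0 → ℕ) → ∑ f ≡ 0
    ∑-empty f = refl

    ∑-suc : ∀ {n} (f : Fin (suc n) → ℕ) → ∑ f ≡ f zero + ∑ (f ∘ suc)
    ∑-suc f = refl

    ∑-mono : ∀ {n} {f g : Fin n → ℕ} → (∀ x → f x ≤ g x) → ∑ f ≤ ∑ g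
    ∑-mono {zero} f≤g = z≤n
    ∑-mono {suc n} f≤g = +-mono-≤ (f≤g zero) (∑-mono (f≤g ∘ suc))

    ∑-cong : ∀ {n} {f g : Fin n → ℕ} → (∀ x → f x ≡ g x) → ∑ f ≡ ∑ g
    ∑-cong = sum-cong-≗

    ∑-+ : ∀ {n} (f g : Fin n → ℕ) → ∑ (λ x → f x + g x) ≡ ∑ f + ∑ g
    ∑-+ = ∑-distrib-+

    ∑-* : ∀ {n} c (f : Fin n → ℕ) → ∑ (λ x → c * f x) ≡ c * ∑ f
    ∑-* c f = sym (*-distribˡ-sum c f)

    ∑-swap : ∀ {m n} (f : Fin m → Fin n → ℕ) →
             ∑ (λ x → ∑ (f x)) ≡ ∑ (λ y → ∑ (λ x → f x y))
    ∑-swap f = ∑-comm f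

  ∑-const : ∀ {n} c → ∑ {n} (λ _ → c) ≡ n * c
  ∑-const {zero} c = ∑-empty _
  ∑-const {suc n} c = trans (∑-suc _) (cong (c +_) (∑-const {n} c))

  ∑-zero : ∀ {n} {f : Fin n → ℕ} → (∀ x → f x ≡ 0) → ∑ f ≡ 0
  ∑-zero {n} f≡0 = trans (∑-cong f≡0) (trans (∑-const {n} 0) (*-zeroʳ n))

  _==_ : ∀ {n} → Fin n → Fin n → Bool
  x == y = does (x ≟ y)

  ==-refl : ∀ {n} (x : Fin n) → (x == x) ≡ true
  ==-refl x = dec-true (x ≟ x) refl

  ==-≢ : ∀ {n} {x y : Fin n} → x ≢ y → (x == y) ≡ false
  ==-≢ {x = x} {y} = dec-false (x ≟ y)

  ==⇒≡ : ∀ {n} {x y : Fin n} → (x == y) ≡ true → x ≡ y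
  ==⇒≡ {x = x} {y} e with x ≟ y | e
  ... | yes p | _ = p
  ... | no _ | ()

  ∑-δ : ∀ {n} (a : Fin n) (f : Fin n → ℕ) → ∑ (λ x → ⟦ x == a ⟧ * f x) ≡ f a
  ∑-δ zero f = trans (∑-suc _)
    (trans (cong₂ _+_ (+-identityʳ (f zero)) (∑-zero λ _ → refl)) (+-identityʳ _))
  ∑-δ (suc a) f = trans (∑-suc _) (∑-δ a (f ∘ suc))

  term≤∑ : ∀ {n} (f : Fin n → ℕ) a → f a ≤ ∑ f
  term≤∑ f a = subst (_≤ ∑ f) (∑-δ a f) (∑-mono λ x → scaled (x == a) (f x))
    where
    scaled : ∀ b m → ⟦ b ⟧ * m ≤ m
    scaled true m = ≤-reflexive (+-identityʳ m)
    scaled false m = z≤n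

  ∑-pos : ∀ {n} (f : Fin n → ℕ) → 1 ≤ ∑ f → ∃[ x ] (1 ≤ f x)
  ∑-pos {zero} f h = ⊥-elim (1+n≰n (≤-trans h (≤-reflexive (∑-empty f))))
  ∑-pos {suc n} f h with f zero in e
  ... | suc k = zero , subst (1 ≤_) (sym e) (s≤s z≤n)
  ... | zero with ∑-pos (f ∘ suc) (≤-trans h (≤-reflexive (trans (∑-suc f) (cong (_+ ∑ (f ∘ suc)) e))))
  ...   | x , q = suc x , q

  # : ∀ {n} → (Fin n → Bool) → ℕ
  # p = ∑ (λ x → ⟦ p x ⟧)

  #-mono : ∀ {n} {p q : Fin n → Bool} → (∀ x → p x ≡ true → q x ≡ true) → # p ≤ # q
  #-mono {p = p} {q} h = ∑-mono λ x → imp (p x) (q x) (h x)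
    where
    imp : ∀ a b → (a ≡ true → b ≡ true) → ⟦ a ⟧ ≤ ⟦ b ⟧
    imp false b h = z≤n
    imp true b h rewrite h refl = ≤-refl

  ⟦⟧-pos : ∀ {b} → 1 ≤ ⟦ b ⟧ → b ≡ true
  ⟦⟧-pos {true} _ = refl

  #-pos : ∀ {n} (p : Fin n → Bool) → 1 ≤ # p → ∃[ x ] (p x ≡ true)
  #-pos p h with ∑-pos (⟦_⟧ ∘ p) h
  ... | x , q = x , ⟦⟧-pos q

  ∈⇒1≤# : ∀ {n} (p : Fin n → Bool) {x} → p x ≡ true → 1 ≤ # p
  ∈⇒1≤# p {x} e = ≤-trans (≤-reflexive (cong ⟦_⟧ (sym e))) (term≤∑ (⟦_⟧ ∘ p) x)

  ∧-true : ∀ {a b} → a ∧ b ≡ true → a ≡ true × b ≡ true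
  ∧-true {true} {true} _ = refl , refl

  true-∧ : ∀ {a b} → a ≡ true → b ≡ true → a ∧ b ≡ true
  true-∧ refl refl = refl

  ∨-introʳ : ∀ {a b} → b ≡ true → a ∨ b ≡ true
  ∨-introʳ {true} _ = refl
  ∨-introʳ {false} e = e

  ∨-introˡ : ∀ {a b} → a ≡ true → a ∨ b ≡ true
  ∨-introˡ refl = refl

  true? : ∀ b → b ≡ true ⊎ b ≡ false
  true? true = inj₁ refl
  true? false = inj₂ refl

  true≢false : ∀ {b} {A : Set} → b ≡ true → b ≡ false → A
  true≢false refl ()

  -- White degrees, closed neighbourhoods and the gain of an edge

  module Cover {n : ℕ} (adj : Fin n → Fin n → Bool)
    (adj-sym : ∀ x y → adj x y ≡ adj y x)
    (adj-irr : ∀ x → adj x x ≡ false)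
    (deg≥4 : ∀ x → 4 ≤ # (adj x)) where

    -- U is the set of vertices not yet dominated.  They are called white, the others blue.
    d : (Fin n → Bool) → Fin n → ℕ
    d U x = # (λ y → adj x y ∧ U y)

    _∖_ : (Fin n → Bool) → (Fin n → Bool) → Fin n → Bool
    (U ∖ C) x = U x ∧ not (C x)

    -- The closed neighbourhood `N[a]`. Thus `dom a b` is `N[a] ∪ N[b]`, and `p U a` is the size of
    -- `N[a] ∩ U`.
    cov : Fin n → Fin n → Bool
    cov a x = (x == a) ∨ adj a x

    dom : Fin n → Fin n → Fin n → Bool
    dom a b x = cov a x ∨ cov b x

    p : (Fin n → Bool) → Fin n → ℕ
    p U a = # (λ x → U x ∧ cov a x)

    gain : (Fin n → Bool) → Fin n → Fin n → ℕ
    gain U a b = # (λ x → U x ∧ dom a b x)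

    cov-self : ∀ a → cov a a ≡ true
    cov-self a = ∨-introˡ (==-refl a)

    adj⇒cov : ∀ {a x} → adj a x ≡ true → cov a x ≡ true
    adj⇒cov {a} {x} e = ∨-introʳ {x == a} e

    adj-comm : ∀ {x y} → adj x y ≡ true → adj y x ≡ true
    adj-comm {x} {y} e = trans (adj-sym y x) e

    adj⇒≢ : ∀ {x y} → adj x y ≡ true → x ≢ y
    adj⇒≢ e refl = true≢false e (adj-irr _)

    d-split : ∀ U C z → d U z ≡ d (U ∖ C) z + d (λ x → U x ∧ C x) z
    d-split U C z =
      trans (∑-cong λ y → split (adj z y) (U y) (C y)) (∑-+ {n} _ _)
      where
      split : ∀ a u c → ⟦ a ∧ u ⟧ ≡ ⟦ a ∧ u ∧ not c ⟧ + ⟦ a ∧ u ∧ c ⟧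
      split false u c = refl
      split true false c = refl
      split true true false = refl
      split true true true = refl

    d-mono : ∀ {U V} → (∀ x → U x ≡ true → V x ≡ true) → ∀ z → d U z ≤ d V z
    d-mono {U} {V} U⊆V z =
      #-mono {p = λ y → adj z y ∧ U y} λ y e → let (s , t) = ∧-true {adj z y} e in true-∧ s (U⊆V y t)

    p-white : ∀ U {a} → U a ≡ true → p U a ≡ 1 + d U a
    p-white U {a} ua =
      trans (∑-cong λ x → split x (x ≟ a)) (trans (∑-+ {n} _ _) (cong (_+ d U a) (∑-δ a (λ _ → 1))))
      where
      split : ∀ x → Dec (x ≡ a) → ⟦ U x ∧ cov a x ⟧ ≡ ⟦ x == a ⟧ * 1 + ⟦ adj a x ∧ U x ⟧
      split x (yes refl) rewrite ua | ==-refl x | adj-irr x = refl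
      split x (no x≢a) rewrite ==-≢ x≢a with U x | adj a x
      ... | true | true = refl
      ... | true | false = refl
      ... | false | true = refl
      ... | false | false = refl

    p-blue : ∀ U {a} → U a ≡ false → p U a ≡ d U a
    p-blue U {a} ua = ∑-cong λ x → split x (x ≟ a)
      where
      split : ∀ x → Dec (x ≡ a) → ⟦ U x ∧ cov a x ⟧ ≡ ⟦ adj a x ∧ U x ⟧
      split x (yes refl) rewrite ua | adj-irr x = refl
      split x (no x≢a) rewrite ==-≢ x≢a with U x | adj a x
      ... | true | true = refl
      ... | true | false = refl
      ... | false | true = refl
      ... | false | false = refl

    -- The vertices of N[a] and the remaining neighbours of x are disjoint, and
    -- the edge ax dominates all of them.
    nbr-bound : ∀ U C {a x} → adj a x ≡ true → (∀ y → cov a y ≡ true → C y ≡ true) →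
                d (U ∖ C) x + p U a ≤ gain U a x
    nbr-bound U C {a} {x} ax cov⊆C =
      ≤-trans (≤-reflexive (sym (∑-+ {n} _ _))) (∑-mono λ y → bound y (true? (cov a y)))
      where
      bound : ∀ y → cov a y ≡ true ⊎ cov a y ≡ false →
              ⟦ adj x y ∧ U y ∧ not (C y) ⟧ + ⟦ U y ∧ cov a y ⟧ ≤ ⟦ U y ∧ (cov a y ∨ cov x y) ⟧
      bound y (inj₁ e) rewrite cov⊆C y e | e with adj x y | U y
      ... | true | true = ≤-refl
      ... | true | false = ≤-refl
      ... | false | true = ≤-refl
      ... | false | false = ≤-refl
      bound y (inj₂ e) rewrite e with adj x y | U y | C y | y == x
      ... | true | true | true | true = z≤n
      ... | true | true | true | false = z≤n
      ... | true | true | false | true = ≤-refl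
      ... | true | true | false | false = ≤-refl
      ... | true | false | _ | _ = ≤-refl
      ... | false | true | _ | _ = z≤n
      ... | false | false | _ | _ = ≤-refl

    d-covered : ∀ U C {a} → (∀ y → cov a y ≡ true → C y ≡ true) → d (U ∖ C) a ≡ 0
    d-covered U C {a} cov⊆C = ∑-zero λ y → none y (true? (adj a y))
      where
      none : ∀ y → adj a y ≡ true ⊎ adj a y ≡ false → ⟦ adj a y ∧ U y ∧ not (C y) ⟧ ≡ 0
      none y (inj₁ e) rewrite cov⊆C y (adj⇒cov e) | e with U y
      ... | true = refl
      ... | false = refl
      none y (inj₂ e) rewrite e = refl

    covˡ : ∀ a b y → cov a y ≡ true → dom a b y ≡ true
    covˡ a b y e = ∨-introˡ e

    covʳ : ∀ a b y → cov b y ≡ true → dom a b y ≡ true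
    covʳ a b y e = ∨-introʳ {cov a y} e

    -- The potential of the dense phase

    -- The weight of a blue vertex with k white neighbours.  A white vertex weighs 350 and every
    -- chosen edge has to free 1190, whence 350 / 1190 = 5 / 17 edges per vertex.
    β : ℕ → ℕ
    β 0 = 0
    β 1 = 210
    β 2 = 238
    β 3 = 268
    β (suc (suc (suc (suc _)))) = 288

    -- What is set free when a white vertex turns blue and keeps `k` white neighbours. All weights
    -- are ten times those of the overview, which makes them integers.
    W : ℕ → ℕ
    W k = 350 ∸ β k

    β≤350 : ∀ k → β k ≤ 350
    β≤350 0 = z≤n
    β≤350 1 = m≤m+n 210 140
    β≤350 2 = m≤m+n 238 112
    β≤350 3 = m≤m+n 268 82
    β≤350 (suc (suc (suc (suc _)))) = m≤m+n 288 62

    W+β : ∀ k → W k + β k ≡ 350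
    W+β k = m∸n+n≡m (β≤350 k)

    β-step : ∀ k → β k ≤ β (suc k)
    β-step 0 = z≤n
    β-step 1 = m≤m+n 210 28
    β-step 2 = m≤m+n 238 30
    β-step 3 = m≤m+n 268 20
    β-step (suc (suc (suc (suc _)))) = ≤-refl

    β-mono : ∀ {i j} → i ≤ j → β i ≤ β j
    β-mono {i} i≤j = go (≤⇒≤′ i≤j)
      where
      open import Data.Nat using (_≤′_; ≤′-refl; ≤′-step)
      go : ∀ {j} → i ≤′ j → β i ≤ β j
      go ≤′-refl = ≤-refl
      go (≤′-step h) = ≤-trans (go h) (β-step _)

    W-anti : ∀ {i j} → i ≤ j → W j ≤ W i
    W-anti i≤j = ∸-monoʳ-≤ 350 (β-mono i≤j)

    φ : Bool → ℕ → ℕ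
    φ true _ = 350
    φ false k = β k

    Φ : (Fin n → Bool) → ℕ
    Φ U = ∑ (λ x → φ (U x) (d U x))

    -- The drop of the potential caused by one edge

    i10 i01 i11 : (Fin n → Bool) → Fin n → Fin n → ℕ
    i10 U a b = # (λ x → U x ∧ cov a x ∧ not (cov b x))
    i01 U a b = # (λ x → U x ∧ not (cov a x) ∧ cov b x)
    i11 U a b = # (λ x → U x ∧ cov a x ∧ cov b x)

    pˡ-split : ∀ U a b → p U a ≡ i10 U a b + i11 U a b
    pˡ-split U a b =
      trans (∑-cong λ x → split (U x) (cov a x) (cov b x)) (∑-+ {n} _ _)
      where
      split : ∀ u c e → ⟦ u ∧ c ⟧ ≡ ⟦ u ∧ c ∧ not e ⟧ + ⟦ u ∧ c ∧ e ⟧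
      split false c e = refl
      split true false e = refl
      split true true false = refl
      split true true true = refl

    pʳ-split : ∀ U a b → p U b ≡ i01 U a b + i11 U a b
    pʳ-split U a b =
      trans (∑-cong λ x → split (U x) (cov a x) (cov b x)) (∑-+ {n} _ _)
      where
      split : ∀ u c e → ⟦ u ∧ e ⟧ ≡ ⟦ u ∧ not c ∧ e ⟧ + ⟦ u ∧ c ∧ e ⟧
      split false c e = refl
      split true false e = sym (+-identityʳ _)
      split true true e = refl

    gain-split : ∀ U a b → gain U a b ≡ i10 U a b + i01 U a b + i11 U a b
    gain-split U a b =
      trans (∑-cong λ x → split (U x) (cov a x) (cov b x))
            (trans (∑-+ {n} _ _) (cong (_+ i11 U a b) (∑-+ {n} _ _)))
      where
      split : ∀ u c e → ⟦ u ∧ (c ∨ e) ⟧ ≡ ⟦ u ∧ c ∧ not e ⟧ + ⟦ u ∧ not c ∧ e ⟧ + ⟦ u ∧ c ∧ e ⟧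
      split false c e = refl
      split true false e = sym (+-identityʳ _)
      split true true false = refl
      split true true true = refl

    -- The vertex `a` keeps no white neighbour. If white, it frees 350 but is counted with only `m`
    -- among the vertices of `i11`; if blue, it frees its whole weight.
    endBonus : (Fin n → Bool) → Fin n → ℕ → ℕ
    endBonus U a m = if U a then 350 ∸ m else β (d U a)

    -- The number of edges between `S` and the blue vertices other than `a`. The loss at `a` itself
    -- is already booked in `endBonus`.
    incidence : (Fin n → Bool) → (Fin n → Bool) → Fin n → ℕ
    incidence U S a = ∑ (λ z → ⟦ not (U z) ∧ not (z == a) ⟧ * d S z)

    -- Da and Db bound the number of white neighbours left to the vertices removed from U; κ is
    -- what a blue vertex pays for each of its neighbours in S, a part of the removed set.
    module Step (U : Fin n → Bool) (a b : Fin n) (S : Fin n → Bool) (Da Db κ : ℕ)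
      (ab : adj a b ≡ true) (ub : U b ≡ true)
      (bound-a : ∀ x → U x ≡ true → adj a x ≡ true → d (U ∖ dom a b) x ≤ Da)
      (bound-b : ∀ x → U x ≡ true → adj b x ≡ true → d (U ∖ dom a b) x ≤ Db)
      (bound-κ : ∀ z → U z ≡ false → z ≢ a →
                 κ * d S z + β (d (U ∖ dom a b) z) ≤ β (d U z))
      where

      U' : Fin n → Bool
      U' = U ∖ dom a b

      -- A vertex in both neighbourhoods is subject to both bounds, so it frees the larger of the
      -- two amounts.
      m : ℕ
      m = W Da ⊔ W Db

      m≤350 : m ≤ 350
      m≤350 = ⊔-lub (m∸n≤m 350 (β Da)) (m∸n≤m 350 (β Db))

      cell : Bool → Bool → Bool → ℕ
      cell u c e = W Da * ⟦ u ∧ c ∧ not e ⟧ + W Db * ⟦ u ∧ not c ∧ e ⟧ + m * ⟦ u ∧ c ∧ e ⟧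

      -- The drop is proved vertex by vertex: `τ x` is a lower bound for what `x` frees, made up of
      -- its cell, the corrections at the two ends and the payment of a blue vertex for its
      -- neighbours in `S`.
      τ : Fin n → ℕ
      τ x = cell (U x) (cov a x) (cov b x)
          + ((350 ∸ m) * ⟦ x == b ⟧ + endBonus U a m * ⟦ x == a ⟧)
          + κ * (⟦ not (U x) ∧ not (x == a) ⟧ * d S x)

      total : ℕ
      total = W Da * i10 U a b + W Db * i01 U a b + m * i11 U a b
            + ((350 ∸ m) + endBonus U a m) + κ * incidence U S a

      ∑τ : ∑ τ ≡ total
      ∑τ = trans (∑-+ {n} _ (λ x → κ * (⟦ not (U x) ∧ not (x == a) ⟧ * d S x)))
                 (cong₂ _+_ (trans (∑-+ {n} (λ x → cell (U x) (cov a x) (cov b x)) _) (cong₂ _+_ cells ends))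
                            (∑-* κ (λ x → ⟦ not (U x) ∧ not (x == a) ⟧ * d S x)))
        where
        scaled : ∀ c (q : Fin n → Bool) → ∑ (λ x → c * ⟦ q x ⟧) ≡ c * # q
        scaled c q = ∑-* c (λ x → ⟦ q x ⟧)
        cells : ∑ (λ x → cell (U x) (cov a x) (cov b x)) ≡
                W Da * i10 U a b + W Db * i01 U a b + m * i11 U a b
        cells =
          trans (∑-+ {n} _ (λ x → m * ⟦ U x ∧ cov a x ∧ cov b x ⟧))
            (cong₂ _+_ (trans (∑-+ {n} (λ x → W Da * ⟦ U x ∧ cov a x ∧ not (cov b x) ⟧)
                                       (λ x → W Db * ⟦ U x ∧ not (cov a x) ∧ cov b x ⟧))
                         (cong₂ _+_ (scaled (W Da) _) (scaled (W Db) _)))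
                       (scaled m _))
        at : ∀ c (w : Fin n) → ∑ (λ x → c * ⟦ x == w ⟧) ≡ c
        at c w = trans (∑-cong λ x → *-comm c ⟦ x == w ⟧) (∑-δ w (λ _ → c))
        ends : ∑ (λ x → (350 ∸ m) * ⟦ x == b ⟧ + endBonus U a m * ⟦ x == a ⟧) ≡ (350 ∸ m) + endBonus U a m
        ends = trans (∑-+ {n} (λ x → (350 ∸ m) * ⟦ x == b ⟧) (λ x → endBonus U a m * ⟦ x == a ⟧))
                 (cong₂ _+_ (at (350 ∸ m) b) (at (endBonus U a m) a))

      cell-blue : ∀ c e → cell false c e ≡ 0
      cell-blue c e rewrite *-zeroʳ (W Da) | *-zeroʳ (W Db) | *-zeroʳ m = refl

      cell-10 : cell true true false ≡ W Da
      cell-10 rewrite *-zeroʳ m | *-zeroʳ (W Db) | *-identityʳ (W Da) = trans (+-identityʳ _) (+-identityʳ _)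

      cell-01 : cell true false true ≡ W Db
      cell-01 rewrite *-zeroʳ m | *-zeroʳ (W Da) | *-identityʳ (W Db) = +-identityʳ _

      cell-11 : cell true true true ≡ m
      cell-11 rewrite *-zeroʳ (W Da) | *-zeroʳ (W Db) = *-identityʳ m

      cell-00 : cell true false false ≡ 0
      cell-00 rewrite *-zeroʳ (W Da) | *-zeroʳ (W Db) | *-zeroʳ m = refl

      a≢b : a ≢ b
      a≢b = adj⇒≢ ab

      Goal : Fin n → Set
      Goal x = τ x + φ (U' x) (d U' x) ≤ φ (U x) (d U x)

      -- The white vertex `b` lies in both closed neighbourhoods and keeps no white neighbour, so it
      -- frees 350: `m` from its cell and `350 ∸ m` from the correction.
      at-b : Goal b
      at-b rewrite d-covered U (dom a b) {b} (covʳ a b) | ub | ==-refl b | ==-≢ {x = b} {a} (a≢b ∘ sym)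
        | ab | cell-11 | *-zeroʳ κ | *-zeroʳ (endBonus U a m) =
        ≤-reflexive (trans (+-identityʳ _) (trans (+-identityʳ _) (trans (cong (m +_) (trans (+-identityʳ _) (*-identityʳ _))) (m+[n∸m]≡n m≤350))))

      at-a : Goal a
      at-a with U a in ua
      ... | false rewrite d-covered U (dom a b) {a} (covˡ a b) | ==-refl a | ==-≢ a≢b | cell-blue (cov a a) (cov b a)
        | *-zeroʳ κ | *-zeroʳ (350 ∸ m) = ≤-reflexive (trans (+-identityʳ _) (trans (+-identityʳ _) (*-identityʳ _)))
      ... | true rewrite d-covered U (dom a b) {a} (covˡ a b) | ==-refl a | ==-≢ a≢b | adj-sym b a | ab
        | cell-11 | *-zeroʳ κ | *-zeroʳ (350 ∸ m) =
        ≤-reflexive (trans (+-identityʳ _) (trans (+-identityʳ _) (trans (cong (m +_) (*-identityʳ _)) (m+[n∸m]≡n m≤350))))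

      fits : ∀ {w} k → w ≤ W k → w + β k ≤ 350
      fits k w≤ = ≤-trans (+-monoˡ-≤ (β k) w≤) (≤-reflexive (W+β k))

      other : ∀ x → x ≢ a → x ≢ b → Goal x
      other x x≢a x≢b with U x in ux
      ... | false rewrite ==-≢ x≢a | ==-≢ x≢b | cell-blue (adj a x) (adj b x) | *-zeroʳ (350 ∸ m)
        | *-zeroʳ (endBonus U a m) | +-identityʳ (d S x) = bound-κ x ux x≢a
      ... | true rewrite ==-≢ x≢a | ==-≢ x≢b | *-zeroʳ (350 ∸ m) | *-zeroʳ (endBonus U a m) | *-zeroʳ κ
        with adj a x in ax | adj b x in bx
      ... | false | false rewrite cell-00 = ≤-refl
      ... | true | false rewrite cell-10 | +-identityʳ (W Da) | +-identityʳ (W Da) =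
        fits (d U' x) (W-anti (bound-a x ux ax))
      ... | false | true rewrite cell-01 | +-identityʳ (W Db) | +-identityʳ (W Db) =
        fits (d U' x) (W-anti (bound-b x ux bx))
      ... | true | true rewrite cell-11 | +-identityʳ m | +-identityʳ m =
        fits (d U' x) (⊔-lub (W-anti (bound-a x ux ax)) (W-anti (bound-b x ux bx)))

      drop : Φ U' + total ≤ Φ U
      drop = ≤-trans (≤-reflexive (trans (cong (Φ U' +_) (sym ∑τ)) (trans (+-comm (Φ U') _) (sym (∑-+ {n} τ _)))))
                     (∑-mono λ x → goal x (x ≟ a) (x ≟ b))
        where
        goal : ∀ x → Dec (x ≡ a) → Dec (x ≡ b) → Goal x
        goal x (yes refl) _ = at-a
        goal x (no _) (yes refl) = at-b
        goal x (no x≢a) (no x≢b) = other x x≢a x≢b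

    -- Counting edges to blue vertices

    blueDegree : (Fin n → Bool) → Fin n → ℕ
    blueDegree U y = # (λ z → adj y z ∧ not (U z))

    -- The closed neighbourhood of `y` has at least five vertices, and `y` itself is among the white
    -- ones. This is how the minimum degree enters the dense phase.
    5≤blueDegree+p : ∀ U {y} → U y ≡ true → 5 ≤ blueDegree U y + p U y
    5≤blueDegree+p U {y} uy = subst (λ m → 5 ≤ blueDegree U y + m) (sym (p-white U uy))
      (≤-trans (s≤s (≤-trans (deg≥4 y) (≤-reflexive all))) (≤-reflexive (sym (+-suc (blueDegree U y) (d U y)))))
      where
      split : ∀ a u → ⟦ a ⟧ ≡ ⟦ a ∧ not u ⟧ + ⟦ a ∧ u ⟧
      split false u = refl
      split true false = refl
      split true true = refl
      all : # (adj y) ≡ blueDegree U y + d U y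
      all = trans (∑-cong λ z → split (adj y z) (U z)) (∑-+ {n} _ _)

    -- Double counting of the edges between `S` and the blue vertices.
    inc-total : ∀ U S → ∑ (λ z → ⟦ not (U z) ⟧ * d S z) ≡ ∑ (λ y → ⟦ S y ⟧ * blueDegree U y)
    inc-total U S =
      trans (∑-cong λ z → sym (∑-* ⟦ not (U z) ⟧ (λ y → ⟦ adj z y ∧ S y ⟧)))
      (trans (∑-swap (λ z y → ⟦ not (U z) ⟧ * ⟦ adj z y ∧ S y ⟧))
      (∑-cong λ y → trans (∑-cong λ z → flip y z) (∑-* ⟦ S y ⟧ (λ z → ⟦ adj y z ∧ not (U z) ⟧))))
      where
      swap : ∀ u e s → ⟦ u ⟧ * ⟦ e ∧ s ⟧ ≡ ⟦ s ⟧ * ⟦ e ∧ u ⟧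
      swap false false false = refl
      swap false false true = refl
      swap false true false = refl
      swap false true true = refl
      swap true false false = refl
      swap true false true = refl
      swap true true false = refl
      swap true true true = refl
      flip : ∀ y z → ⟦ not (U z) ⟧ * ⟦ adj z y ∧ S y ⟧ ≡ ⟦ S y ⟧ * ⟦ adj y z ∧ not (U z) ⟧
      flip y z rewrite adj-sym z y = swap (not (U z)) (adj y z) (S y)

    inc-white : ∀ U S {a} → U a ≡ true → ∑ (λ y → ⟦ S y ⟧ * blueDegree U y) ≤ incidence U S a
    inc-white U S {a} ua = ≤-trans (≤-reflexive (sym (inc-total U S))) (∑-mono λ z → bound z (z ≟ a))
      where
      bound : ∀ z → Dec (z ≡ a) → ⟦ not (U z) ⟧ * d S z ≤ ⟦ not (U z) ∧ not (z == a) ⟧ * d S z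
      bound z (yes refl) rewrite ua = z≤n
      bound z (no z≢a) rewrite ==-≢ z≢a | Bool.∧-identityʳ (not (U z)) = ≤-refl

    -- A blue `a` is left out of `incidence`, which costs its own edges to `S`; for a white `a`
    -- nothing is lost.
    inc-blue : ∀ U S a → ∑ (λ y → ⟦ S y ⟧ * blueDegree U y) ≤ incidence U S a + d S a
    inc-blue U S a = ≤-trans (≤-reflexive (sym (inc-total U S)))
      (≤-trans (∑-mono λ z → bound z (z ≟ a))
        (≤-reflexive (trans (∑-+ {n} (λ z → ⟦ not (U z) ∧ not (z == a) ⟧ * d S z) (λ z → ⟦ z == a ⟧ * d S z))
          (cong (incidence U S a +_) (∑-δ a (d S))))))
      where
      bound : ∀ z → Dec (z ≡ a) →
              ⟦ not (U z) ⟧ * d S z ≤ ⟦ not (U z) ∧ not (z == a) ⟧ * d S z + ⟦ z == a ⟧ * d S z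
      bound z (yes refl) rewrite ==-refl z =
        ≤-trans (*-monoˡ-≤ (d S z) (⟦⟧≤1 (not (U z)))) (m≤n+m (1 * d S z) (⟦ not (U z) ∧ false ⟧ * d S z))
      bound z (no z≢a) rewrite ==-≢ z≢a | Bool.∧-identityʳ (not (U z)) = m≤m+n _ _

    -- Greedy edges that pay for themselves at once

    removed : (Fin n → Bool) → Fin n → Fin n → Fin n → Bool
    removed U a b x = U x ∧ dom a b x

    -- Only edges with a white end compete, since `Step` needs `b` to be white.
    Bounded : (Fin n → Bool) → ℕ → Set
    Bounded U g = ∀ a b → adj a b ≡ true → U b ≡ true → gain U a b ≤ g

    WhiteBounded : (Fin n → Bool) → ℕ → Set
    WhiteBounded U g = ∀ a b → adj a b ≡ true → U a ≡ true → U b ≡ true → gain U a b ≤ g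

    Done : (Fin n → Bool) → Set
    Done U = ∃[ a ] ∃[ b ] (adj a b ≡ true × U b ≡ true × Φ (U ∖ dom a b) + 1190 ≤ Φ U)

    p≤gain : ∀ U a b → p U a ≤ gain U a b
    p≤gain U a b = #-mono {p = λ x → U x ∧ cov a x} λ x e →
      let (u , c) = ∧-true {U x} e in true-∧ u (covˡ a b x c)

    gain-comm : ∀ U a b → gain U a b ≡ gain U b a
    gain-comm U a b = ∑-cong λ x → cong (λ t → ⟦ U x ∧ t ⟧) (Bool.∨-comm (cov a x) (cov b x))

    #≤n : (q : Fin n → Bool) → # q ≤ n
    #≤n q = ≤-trans (∑-mono λ x → ⟦⟧≤1 (q x)) (≤-reflexive (trans (∑-const {n} 1) (*-identityʳ n)))

    keep⊆ : ∀ U C x → (U ∖ C) x ≡ true → U x ≡ true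
    keep⊆ U C x e = proj₁ (∧-true {U x} e)

    no-surcharge : ∀ U C S z → 0 * d S z + β (d (U ∖ C) z) ≤ β (d U z)
    no-surcharge U C S z = β-mono (d-mono (keep⊆ U C) z)

    none : Fin n → Bool
    none _ = false

    white-nbr : ∀ U a → 1 ≤ d U a → ∃[ b ] (adj a b ≡ true × U b ≡ true)
    white-nbr U a h with #-pos (λ y → adj a y ∧ U y) h
    ... | b , e = b , ∧-true {adj a b} e

    -- If no edge from `a` to a white vertex gains more than `N[a]` does alone, then by `nbr-bound`
    -- the white neighbours of `a` keep no white neighbour, so each white vertex of `N[a]` frees the
    -- full 350. Any white neighbour can serve as `b`.
    closed : ∀ U a → 1 ≤ d U a →
             (∀ x → adj a x ≡ true → U x ≡ true → gain U a x ≤ p U a) →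
             1190 ≤ 350 * p U a + endBonus U a 350 → Done U
    closed U a nbr gain≤p enough with white-nbr U a nbr
    ... | b , ab , ub = a , b , ab , ub , ≤-trans (+-monoʳ-≤ (Φ (U ∖ dom a b)) worth) St.drop
      where
      untouched : ∀ x → U x ≡ true → adj a x ≡ true → d (U ∖ dom a b) x ≤ 0
      untouched x ux ax = +-cancelʳ-≤ (p U a) _ 0 (≤-trans (nbr-bound U (dom a b) ax (covˡ a b)) (gain≤p x ax ux))
      -- On the side of `b` only the trivial bound `n` is available; `m` is 350 already because of
      -- the bound 0 on the side of `a`.
      module St = Step U a b none 0 n 0 ab ub untouched (λ x _ _ → #≤n (λ y → adj x y ∧ (U ∖ dom a b) y))
                    (λ z _ _ → no-surcharge U (dom a b) none z)
      m≡350 : St.m ≡ 350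
      m≡350 = m≥n⇒m⊔n≡m (m∸n≤m 350 (β n))
      worth : 1190 ≤ St.total
      worth rewrite m≡350 = ≤-trans enough
        (≤-trans (+-monoˡ-≤ (endBonus U a 350)
          (≤-trans (≤-reflexive (trans (cong (350 *_) (pˡ-split U a b)) (*-distribˡ-+ 350 (i10 U a b) (i11 U a b))))
                   (+-monoˡ-≤ (350 * i11 U a b) (m≤m+n (350 * i10 U a b) (W n * i01 U a b)))))
          (m≤m+n _ 0))

    closed-white : ∀ U a → U a ≡ true → 4 ≤ p U a →
                   (∀ x → adj a x ≡ true → U x ≡ true → gain U a x ≤ p U a) → Done U
    closed-white U a ua 4≤p gain≤p = closed U a
      (≤-trans (m≤m+n 1 2) (≤-pred (subst (4 ≤_) (p-white U ua) 4≤p))) gain≤p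
      (≤-trans (≤-trans (m≤m+n 1190 210) (*-monoʳ-≤ 350 4≤p)) (m≤m+n (350 * p U a) _))

    -- Three white neighbours free 1050 and `a` frees at least `β 3 = 268`, more than 1190 together.
    closed-blue : ∀ U a → U a ≡ false → 3 ≤ d U a →
                  (∀ x → adj a x ≡ true → U x ≡ true → gain U a x ≤ d U a) → Done U
    closed-blue U a ua 3≤d gain≤d = closed U a (≤-trans (m≤m+n 1 2) 3≤d)
      (λ x ax ux → subst (gain U a x ≤_) (sym (p-blue U ua)) (gain≤d x ax ux)) worth
      where
      worth : 1190 ≤ 350 * p U a + endBonus U a 350
      worth rewrite ua | p-blue U ua =
        ≤-trans (m≤m+n 1190 128) (+-mono-≤ (*-monoʳ-≤ 350 3≤d) (β-mono 3≤d))

    nbr-d : ∀ U {a b} → adj a b ≡ true → U b ≡ true → 1 ≤ d U a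
    nbr-d U {a} {b} ab ub = ∈⇒1≤# (λ y → adj a y ∧ U y) {b} (true-∧ ab ub)

    -- A removed vertex frees at least `350 - 288 = 62` in any case. The end `b` adds 288 and `a` at
    -- least 210, and `12 * 62 + 288 + 210 = 1242`.
    huge : ∀ U a b → adj a b ≡ true → U b ≡ true → 12 ≤ gain U a b → Done U
    huge U a b ab ub h = a , b , ab , ub , ≤-trans (+-monoʳ-≤ (Φ (U ∖ dom a b)) worth) St.drop
      where
      -- With `4 + n` as the trivial bound, `W` computes to 62.
      module St = Step U a b none (4 + n) (4 + n) 0 ab ub
                    (λ x _ _ → ≤-trans (#≤n (λ y → adj x y ∧ (U ∖ dom a b) y)) (m≤n+m n 4))
                    (λ x _ _ → ≤-trans (#≤n (λ y → adj x y ∧ (U ∖ dom a b) y)) (m≤n+m n 4))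
                    (λ z _ _ → no-surcharge U (dom a b) none z)
      ends : 210 ≤ endBonus U a 62
      ends with U a
      ... | true = m≤m+n 210 78
      ... | false = β-mono (nbr-d U ab ub)
      worth : 1190 ≤ St.total
      worth = ≤-trans (≤-trans (m≤m+n 1190 52) (+-mono-≤ (*-monoʳ-≤ 62 h) (+-monoʳ-≤ 288 ends)))
        (≤-trans (+-monoˡ-≤ _ (≤-reflexive (trans (cong (62 *_) (gain-split U a b))
           (trans (*-distribˡ-+ 62 (i10 U a b + i01 U a b) (i11 U a b))
                  (cong (_+ 62 * i11 U a b) (*-distribˡ-+ 62 (i10 U a b) (i01 U a b)))))))
          (m≤m+n _ 0))

    -- Surcharges from the blue neighbours of the removed vertices

    Table : ℕ → ℕ → ℕ → Set
    Table κ e k = κ * k + β e ≤ β (e + k)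

    -- A choice of `S` and `κ` for `Step`, packaged with a lower bound for the resulting last
    -- summand, so that the later arithmetic involves only `bonus`.
    record Surcharge (U : Fin n → Bool) (a b : Fin n) (bonus : ℕ) : Set where
      field
        S     : Fin n → Bool
        κ     : ℕ
        valid : ∀ z → U z ≡ false → z ≢ a →
                κ * d S z + β (d (U ∖ dom a b) z) ≤ β (d U z)
        worth : bonus ≤ κ * incidence U S a

    no-bonus : ∀ U a b → Surcharge U a b 0
    no-bonus U a b = record { S = none ; κ = 0 ; valid = λ z _ _ → no-surcharge U (dom a b) none z ; worth = z≤n }

    -- The vertex `z` loses at least its neighbours in `S`, as these are all removed. `Table` says
    -- that going from `e + k` down to `e` white neighbours frees `κ` for each of the `k`.
    valid-table : ∀ U a b S κ → (∀ x → S x ≡ true → removed U a b x ≡ true) → ∀ z →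
                  Table κ (d (U ∖ dom a b) z) (d S z) →
                  κ * d S z + β (d (U ∖ dom a b) z) ≤ β (d U z)
    valid-table U a b S κ S⊆R z h = ≤-trans h (β-mono
      (≤-trans (+-monoʳ-≤ (d (U ∖ dom a b) z) (d-mono S⊆R z)) (≤-reflexive (sym (d-split U (dom a b) z)))))

    both : Fin n → Fin n → Fin n → Bool
    both a b x = (x == a) ∨ (x == b)

    ∑-both : ∀ {a b} → a ≢ b → (f : Fin n → ℕ) → ∑ (λ x → ⟦ both a b x ⟧ * f x) ≡ f a + f b
    ∑-both {a} {b} a≢b f =
      trans (∑-cong λ x → split x (x ≟ a))
        (trans (∑-+ {n} (λ x → ⟦ x == a ⟧ * f x) (λ x → ⟦ x == b ⟧ * f x)) (cong₂ _+_ (∑-δ a f) (∑-δ b f)))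
      where
      split : ∀ x → Dec (x ≡ a) → ⟦ both a b x ⟧ * f x ≡ ⟦ x == a ⟧ * f x + ⟦ x == b ⟧ * f x
      split x (yes refl) rewrite ==-refl x | ==-≢ a≢b = sym (+-identityʳ _)
      split x (no x≢a) rewrite ==-≢ x≢a = refl

    d-both : ∀ {a b} → a ≢ b → ∀ z → d (both a b) z ≡ ⟦ adj z a ⟧ + ⟦ adj z b ⟧
    d-both {a} {b} a≢b z = trans (∑-cong λ y → swap (adj z y) (both a b y)) (∑-both a≢b (λ y → ⟦ adj z y ⟧))
      where
      swap : ∀ e s → ⟦ e ∧ s ⟧ ≡ ⟦ s ⟧ * ⟦ e ⟧
      swap false false = refl
      swap false true = refl
      swap true false = refl
      swap true true = refl

    -- Here `S` consists of the two ends. A blue neighbour `z` of an end `w` keeps at most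
    -- `g - p U w` white neighbours by `nbr-bound` for the edge `wz`, so `table` is needed only for
    -- `e ≤ E`. Each end has at least `5 - p` blue neighbours, hence at least `c`.
    pair-surcharge : ∀ U a b κ E g c → adj a b ≡ true → U a ≡ true → U b ≡ true → Bounded U g →
                     g ≤ E + p U a → g ≤ E + p U b → p U a + c ≤ 5 → p U b + c ≤ 5 →
                     (∀ e k → e ≤ E → k ≤ 2 → Table κ e k) →
                     Surcharge U a b (κ * (c + c))
    pair-surcharge U a b κ E g c ab ua ub bnd ga gb ca cb table = record
      { S = both a b ; κ = κ
      ; valid = λ z uz z≢a → valid-table U a b (both a b) κ sub z (ok z)
      ; worth = *-monoʳ-≤ κ (≤-trans (≤-trans (+-mono-≤ (few ua ca) (few ub cb))
          (≤-reflexive (sym (∑-both a≢b (blueDegree U))))) (inc-white U (both a b) ua)) }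
      where
      a≢b : a ≢ b
      a≢b = adj⇒≢ ab
      few : ∀ {y} → U y ≡ true → p U y + c ≤ 5 → c ≤ blueDegree U y
      few {y} uy h = +-cancelˡ-≤ (p U y) c (blueDegree U y)
        (≤-trans h (≤-trans (5≤blueDegree+p U uy) (≤-reflexive (+-comm (blueDegree U y) (p U y)))))
      sub : ∀ x → both a b x ≡ true → removed U a b x ≡ true
      sub x e = cases (x ≟ a) e
        where
        cases : Dec (x ≡ a) → both a b x ≡ true → removed U a b x ≡ true
        cases (yes refl) _ = true-∧ ua (covˡ a b x (cov-self x))
        cases (no x≢a) e rewrite ==-≢ x≢a with ==⇒≡ {x = x} e
        ... | refl = true-∧ ub (∨-introʳ {adj a x} (cov-self x))
      U' = U ∖ dom a b
      low : ∀ {w} z → (∀ y → cov w y ≡ true → dom a b y ≡ true) → adj z w ≡ true → U w ≡ true →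
            g ≤ E + p U w → d U' z ≤ E
      low {w} z inc zw uw gw = +-cancelʳ-≤ (p U w) (d U' z) E
        (≤-trans (nbr-bound U (dom a b) (adj-comm zw) inc)
          (≤-trans (≤-reflexive (gain-comm U w z)) (≤-trans (bnd z w zw uw) gw)))
      ok : ∀ z → Table κ (d U' z) (d (both a b) z)
      ok z rewrite d-both a≢b z with adj z a in za | adj z b in zb
      ... | false | false rewrite *-zeroʳ κ | +-identityʳ (d U' z) = ≤-refl
      ... | true | eb = table (d U' z) _ (low z (covˡ a b) za ua ga) (s≤s (⟦⟧≤1 eb))
      ... | false | true = table (d U' z) 1 (low z (covʳ a b) zb ub gb) (s≤s z≤n)

    record Tame (U : Fin n → Bool) (P Q : ℕ) : Set where
      field
        white : ∀ y → U y ≡ true → p U y ≤ P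
        blue  : ∀ z → U z ≡ false → d U z ≤ Q

    -- Here `S` is everything white that `ab` dominates. Each white vertex has at least `L = 5 - P`
    -- blue neighbours, and blue vertices have at most `Q` white ones, so `table` is needed only up
    -- to `Q`.
    module _ (U : Fin n → Bool) (a b : Fin n) (κ P Q L : ℕ) (tame : Tame U P Q)
      (LP : 5 ≡ L + P) (ub : U b ≡ true) (table : ∀ e k → e + k ≤ Q → Table κ e k) where
      open Tame tame

      gone : Fin n → Bool
      gone = removed U a b

      all-valid : ∀ z → U z ≡ false → z ≢ a → κ * d gone z + β (d (U ∖ dom a b) z) ≤ β (d U z)
      all-valid z uz _ = valid-table U a b gone κ (λ _ e → e) z
        (table _ _ (≤-trans (≤-reflexive (sym (d-split U (dom a b) z))) (blue z uz)))

      -- The surplus `P ∸ p U b` of blue neighbours at `b` is kept, because it offsets the deduction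
      -- of `d U a` in `all-blue`.
      all-count : L * gain U a b + (P ∸ p U b) ≤ ∑ (λ y → ⟦ gone y ⟧ * blueDegree U y)
      all-count = ≤-trans (≤-reflexive (sym (trans (∑-+ {n} (λ y → L * ⟦ gone y ⟧) (λ y → ⟦ y == b ⟧ * (P ∸ p U b)))
          (cong₂ _+_ (∑-* L (λ y → ⟦ gone y ⟧)) (∑-δ b (λ _ → P ∸ p U b))))))
        (∑-mono λ y → bound y (y ≟ b))
        where
        share : ∀ y → U y ≡ true → L + (P ∸ p U y) ≤ blueDegree U y
        share y uy = +-cancelʳ-≤ (p U y) _ _ (≤-trans (≤-reflexive
          (trans (+-assoc L (P ∸ p U y) (p U y)) (trans (cong (L +_) (m∸n+n≡m (white y uy))) (sym LP)))) (5≤blueDegree+p U uy))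
        bound : ∀ y → Dec (y ≡ b) → L * ⟦ gone y ⟧ + ⟦ y == b ⟧ * (P ∸ p U b) ≤ ⟦ gone y ⟧ * blueDegree U y
        bound y (yes refl) rewrite ==-refl y | ub | Bool.∨-zeroʳ (cov a y) | *-identityʳ L
          | +-identityʳ (P ∸ p U y) | +-identityʳ (blueDegree U y) = share y ub
        bound y (no y≢b) rewrite ==-≢ y≢b = ≤-trans (≤-reflexive (+-identityʳ _)) (inner y (true? (U y)))
          where
          inner : ∀ y → U y ≡ true ⊎ U y ≡ false → ∀ {e} → L * ⟦ U y ∧ e ⟧ ≤ ⟦ U y ∧ e ⟧ * blueDegree U y
          inner y (inj₂ uy) rewrite uy = ≤-reflexive (*-zeroʳ L)
          inner y (inj₁ uy) {false} rewrite uy = ≤-reflexive (*-zeroʳ L)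
          inner y (inj₁ uy) {true} rewrite uy | *-identityʳ L | +-identityʳ (blueDegree U y) =
            ≤-trans (m≤m+n L _) (share y uy)

      all-white : U a ≡ true → Surcharge U a b (κ * (L * gain U a b))
      all-white ua = record
        { S = gone ; κ = κ ; valid = all-valid
        ; worth = *-monoʳ-≤ κ (≤-trans (m≤m+n (L * gain U a b) (P ∸ p U b)) (≤-trans all-count (inc-white U gone ua))) }

      all-blue : Surcharge U a b (κ * ((L * gain U a b + (P ∸ p U b)) ∸ d U a))
      all-blue = record
        { S = gone ; κ = κ ; valid = all-valid
        ; worth = *-monoʳ-≤ κ (m≤n+o⇒m∸n≤o _ (d U a) (≤-trans all-count (≤-trans (inc-blue U gone a)
            (≤-trans (+-monoʳ-≤ (incidence U gone a) (d-mono (λ x e → proj₁ (∧-true {U x} e)) a))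
              (≤-reflexive (+-comm (incidence U gone a) (d U a))))))) }

    upto : ∀ (κ Q : ℕ) → (∀ e → e < Q → κ + β e ≤ β (suc e)) → ∀ e k → e + k ≤ Q → Table κ e k
    upto κ Q step e zero _ rewrite *-zeroʳ κ | +-identityʳ e = ≤-refl
    upto κ Q step e (suc k) h rewrite *-suc κ k | +-suc e k =
      ≤-trans (≤-reflexive (+-assoc κ (κ * k) (β e)))
        (≤-trans (+-monoʳ-≤ κ (upto κ Q step e k (≤-trans (n≤1+n _) h))) (step (e + k) h))

    -- The increments of `β` are 210, 28, 30, 20: the least one is 20 up to 4, and 28 up to 3.
    table-20 : ∀ e k → e + k ≤ 4 → Table 20 e k
    table-20 = upto 20 4 λ e h → toWitness {a? = allUpTo? (λ e → 20 + β e ≤? β (suc e)) 4} tt h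

    table-28 : ∀ e k → e + k ≤ 3 → Table 28 e k
    table-28 = upto 28 3 λ e h → toWitness {a? = allUpTo? (λ e → 28 + β e ≤? β (suc e)) 3} tt h

    table-pair : ∀ κ E → {True (allUpTo? (λ e → allUpTo? (λ k → κ * k + β e ≤? β (e + k)) 3) (suc E))} →
                 ∀ e k → e ≤ E → k ≤ 2 → Table κ e k
    table-pair κ E {t} e k he hk =
      toWitness t (s≤s he) (s≤s hk)

    -- Finite checks of the arithmetic

    -- r, s and t stand for i01, i10 and i11 of an edge of gain r + s + t, the largest possible;
    -- then r and s themselves are admissible values of Da and Db.
    whiteBonus : ℕ → ℕ
    whiteBonus 2 = 630
    whiteBonus 3 = 168
    whiteBonus 4 = 224
    whiteBonus 5 = 100
    whiteBonus _ = 0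

    whiteDrop : ℕ → ℕ → ℕ → ℕ
    whiteDrop r s t = W r * s + W s * r + m * t + ((350 ∸ m) + (350 ∸ m))
      where m = W r ⊔ W s

    -- Exhaustive computation. Only the triple 2, 2, 2 falls short: it frees 1148, so 42 is missing.
    white-enough : ∀ {r} → r < 12 → ∀ {s} → s < 12 → ∀ {t} → t < 12 → 2 ≤ t → r + s + t ≤ 11 →
                   1190 ≤ whiteDrop r s t + whiteBonus (r + s + t) ⊎ (r ≡ 2 × s ≡ 2 × t ≡ 2)
    white-enough = toWitness {a? = allUpTo? (λ r → allUpTo? (λ s → allUpTo? (λ t →
      (2 ≤? t) →-dec ((r + s + t ≤? 11) →-dec ((1190 ≤? whiteDrop r s t + whiteBonus (r + s + t))
        ⊎-dec ((r ≟ℕ 2) ×-dec ((s ≟ℕ 2) ×-dec (t ≟ℕ 2)))))) 12) 12) 12} tt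

    -- The value of `all-blue` for `q = d U a` and `p' = p U b`, with the constants used in
    -- `blue-surcharge`.
    blueBonus : ℕ → ℕ → ℕ → ℕ
    blueBonus 3 q p' = 28 * ((3 * 3 + (2 ∸ p')) ∸ q)
    blueBonus 4 q p' = 28 * ((2 * 4 + (3 ∸ p')) ∸ q)
    blueBonus 5 q p' = 20 * ((2 * 5 + (3 ∸ p')) ∸ q)
    blueBonus _ _ _ = 0

    -- Here the edges between white vertices all gain less, which allows Db = s ∸ 1.
    blueDrop : ℕ → ℕ → ℕ → ℕ
    blueDrop r s t = W r * s + W (s ∸ 1) * r + m * t + ((350 ∸ m) + β (s + t))
      where m = W r ⊔ W (s ∸ 1)

    -- Exhaustive computation. In the application `r` and `s` are positive because neither end
    -- dominates alone as many white vertices as the edge, and `t` is positive because it counts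
    -- `b`.
    blue-enough : ∀ {r} → r < 12 → ∀ {s} → s < 12 → ∀ {t} → t < 12 →
                  1 ≤ r → 1 ≤ s → 1 ≤ t → 3 ≤ r + s + t → r + s + t ≤ 11 →
                  1190 ≤ blueDrop r s t + blueBonus (r + s + t) (s + t) (r + t)
    blue-enough = toWitness {a? = allUpTo? (λ r → allUpTo? (λ s → allUpTo? (λ t →
      (1 ≤? r) →-dec ((1 ≤? s) →-dec ((1 ≤? t) →-dec ((3 ≤? r + s + t) →-dec ((r + s + t ≤? 11) →-dec
        (1190 ≤? blueDrop r s t + blueBonus (r + s + t) (s + t) (r + t))))))) 12) 12) 12} tt

    -- Edges of largest gain

    drop-done : ∀ U a b Da Db (ab : adj a b ≡ true) (ub : U b ≡ true) →
      (∀ x → U x ≡ true → adj a x ≡ true → d (U ∖ dom a b) x ≤ Da) →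
      (∀ x → U x ≡ true → adj b x ≡ true → d (U ∖ dom a b) x ≤ Db) →
      ∀ {bonus} → Surcharge U a b bonus →
      1190 ≤ W Da * i10 U a b + W Db * i01 U a b + (W Da ⊔ W Db) * i11 U a b
             + ((350 ∸ (W Da ⊔ W Db)) + endBonus U a (W Da ⊔ W Db)) + bonus →
      Done U
    drop-done U a b Da Db ab ub ba bb sur enough =
      a , b , ab , ub , ≤-trans (+-monoʳ-≤ (Φ (U ∖ dom a b)) (≤-trans enough (+-monoʳ-≤ _ (Surcharge.worth sur)))) St.drop
      where module St = Step U a b (Surcharge.S sur) Da Db (Surcharge.κ sur) ab ub ba bb (Surcharge.valid sur)

    p≤ : ∀ U {g y} → 1 ≤ g → WhiteBounded U g → U y ≡ true → p U y ≤ g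
    p≤ U {g} {y} 1≤g wb uy with d U y in e
    ... | zero = ≤-trans (≤-reflexive (trans (p-white U uy) (cong suc e))) 1≤g
    ... | suc k with white-nbr U y (subst (1 ≤_) (sym e) (s≤s z≤n))
    ...   | b , yb , ub = ≤-trans (p≤gain U y b) (wb y b yb uy ub)

    d≤ : ∀ U {g z} → Bounded U g → U z ≡ false → d U z ≤ g
    d≤ U {g} {z} bnd uz with d U z in e
    ... | zero = z≤n
    ... | suc k with white-nbr U z (subst (1 ≤_) (sym e) (s≤s z≤n))
    ...   | b , zb , ub = ≤-trans (≤-reflexive (trans (sym e) (sym (p-blue U uz)))) (≤-trans (p≤gain U z b) (bnd z b zb ub))

    search : {A : Set} {P : Fin n → Set} → (∀ x → Dec (P x)) → (∀ x → P x → A) → A ⊎ (∀ x → ¬ P x)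
    search P? f with any? P?
    ... | yes (x , px) = inj₁ (f x px)
    ... | no none = inj₂ λ x px → none (x , px)

    -- A white vertex that alone reaches the largest gain meets the hypothesis of `closed-white`: no
    -- edge to a white neighbour can gain more.
    whites-below : ∀ U g → 3 ≤ g → WhiteBounded U (suc g) → Done U ⊎ (∀ y → U y ≡ true → p U y ≤ g)
    whites-below U g 3≤g wb = Sum.map₂ (λ none y uy → ≮⇒≥ λ h → none y (uy , h))
      (search (λ y → (U y Bool.≟ true) ×-dec (suc g ≤? p U y))
        (λ y (uy , h) → closed-white U y uy (≤-trans (s≤s 3≤g) h) λ x yx ux → ≤-trans (wb y x yx uy ux) h))

    blues-below : ∀ U g → 2 ≤ g → Bounded U (suc g) → Done U ⊎ (∀ z → U z ≡ false → d U z ≤ g)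
    blues-below U g 2≤g bnd = Sum.map₂ (λ none z uz → ≮⇒≥ λ h → none z (uz , h))
      (search (λ z → (U z Bool.≟ false) ×-dec (suc g ≤? d U z))
        (λ z (uz , h) → closed-blue U z uz (≤-trans (s≤s 2≤g) h) λ x zx ux → ≤-trans (bnd z x zx ux) h))

    whiteBounded : ∀ {U g} → Bounded U g → WhiteBounded U g
    whiteBounded bnd a b ab _ ub = bnd a b ab ub

    tame : ∀ {U P Q} → Done U ⊎ (∀ y → U y ≡ true → p U y ≤ P) → Done U ⊎ (∀ z → U z ≡ false → d U z ≤ Q) →
           Done U ⊎ Tame U P Q
    tame (inj₁ done) _ = inj₁ done
    tame (inj₂ _) (inj₁ done) = inj₁ done
    tame (inj₂ w) (inj₂ b) = inj₂ (record { white = w ; blue = b })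

    -- For gain 3 the white bound stays at 3, since `closed-white` needs at least four white
    -- vertices.
    tame-white : ∀ U k → Bounded U (3 + k) → Done U ⊎ Tame U (3 ⊔ (2 + k)) (2 + k)
    tame-white U zero bnd =
      tame (inj₂ λ y → p≤ U (s≤s z≤n) (whiteBounded bnd)) (blues-below U 2 ≤-refl bnd)
    tame-white U (suc k) bnd =
      tame (whites-below U (3 + k) (m≤m+n 3 k) (whiteBounded bnd)) (blues-below U (3 + k) (m≤m+n 2 (suc k)) bnd)

    two-ends : ∀ U a b → adj a b ≡ true → U a ≡ true → U b ≡ true → 2 ≤ i11 U a b
    two-ends U a b ab ua ub =
      ≤-trans (≤-reflexive (sym (trans (∑-cong λ x → sym (*-identityʳ ⟦ both a b x ⟧)) (∑-both (adj⇒≢ ab) (λ _ → 1)))))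
              (#-mono {p = both a b} λ x e → sub x (x ≟ a) e)
      where
      sub : ∀ x → Dec (x ≡ a) → both a b x ≡ true → U x ∧ cov a x ∧ cov b x ≡ true
      sub x (yes refl) _ = true-∧ ua (true-∧ (cov-self x) (adj⇒cov (adj-comm ab)))
      sub x (no x≢a) e rewrite ==-≢ x≢a with ==⇒≡ {x = x} e
      ... | refl = true-∧ ub (true-∧ ab (cov-self x))

    ≤-component₁ : ∀ {r s t g} → r + s + t ≡ g → g ≤ 11 → r < 12
    ≤-component₁ {r} {s} {t} e h = s≤s (≤-trans (≤-trans (m≤m+n r s) (m≤m+n (r + s) t)) (≤-trans (≤-reflexive e) h))
    ≤-component₂ : ∀ {r s t g} → r + s + t ≡ g → g ≤ 11 → s < 12
    ≤-component₂ {r} {s} {t} e h = s≤s (≤-trans (≤-trans (m≤n+m s r) (m≤m+n (r + s) t)) (≤-trans (≤-reflexive e) h))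
    ≤-component₃ : ∀ {r s t g} → r + s + t ≡ g → g ≤ 11 → t < 12
    ≤-component₃ {r} {s} {t} e h = s≤s (≤-trans (m≤n+m t (r + s)) (≤-trans (≤-reflexive e) h))

    pair : ∀ U a b g → adj a b ≡ true → U a ≡ true → U b ≡ true → Bounded U g →
      ∀ κ E c r s t → {True (allUpTo? (λ e → allUpTo? (λ k → κ * k + β e ≤? β (e + k)) 3) (suc E))} →
      r + s + t ≡ g → p U a ≡ s + t → p U b ≡ r + t → r ≤ E → s ≤ E → s + t + c ≤ 5 → r + t + c ≤ 5 →
      Surcharge U a b (κ * (c + c))
    pair U a b g ab ua ub bnd κ E c r s t {tab} eg ea eb r≤E s≤E ca cb =
      pair-surcharge U a b κ E g c ab ua ub bnd
        (≤-trans (≤-reflexive (trans (sym eg) (+-assoc r s t))) (+-mono-≤ r≤E (≤-reflexive (sym ea))))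
        (≤-trans (≤-reflexive (trans (sym eg) (trans (cong (_+ t) (+-comm r s)) (+-assoc s r t))))
          (+-mono-≤ s≤E (≤-reflexive (sym eb))))
        (subst (λ m → m + c ≤ 5) (sym ea) ca) (subst (λ m → m + c ≤ 5) (sym eb) cb)
        (table-pair κ E {tab})

    -- Gain 2 forces `r = s = 0`: each end has at least three blue neighbours, which keep no white
    -- one, giving `105 * 6 = 630`. For gains 3, 4 and 5 every removed vertex has at least 2, 2 and
    -- 1 blue neighbours, paid at 28, 28 and 20 each.
    white-surcharge : ∀ U a b g → adj a b ≡ true → U a ≡ true → U b ≡ true → gain U a b ≡ g → Bounded U g →
      (∀ k → g ≡ 3 + k → Tame U (3 ⊔ (2 + k)) (2 + k)) →
      ∀ r s t → 2 ≤ t → r + s + t ≡ g → p U a ≡ s + t → p U b ≡ r + t →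
      Surcharge U a b (whiteBonus g)
    white-surcharge U a b 0 _ _ _ _ _ _ r s t _ _ _ _ = no-bonus U a b
    white-surcharge U a b 1 _ _ _ _ _ _ r s t _ _ _ _ = no-bonus U a b
    white-surcharge U a b 2 ab ua ub _ bnd _ r s t 2≤t eg ea eb =
      pair U a b 2 ab ua ub bnd 105 0 3 r s t eg ea eb
        (≤-trans (m≤m+n r s) small) (≤-trans (m≤n+m s r) small)
        (+-monoˡ-≤ 3 (≤-trans (+-monoˡ-≤ t (m≤n+m s r)) (≤-reflexive eg)))
        (+-monoˡ-≤ 3 (≤-trans (+-monoˡ-≤ t (m≤m+n r s)) (≤-reflexive eg)))
      where
      small : r + s ≤ 0
      small = +-cancelʳ-≤ 2 (r + s) 0 (≤-trans (+-monoʳ-≤ (r + s) 2≤t) (≤-reflexive eg))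
    white-surcharge U a b 3 ab ua ub g3 bnd tm _ _ _ _ _ _ _ =
      subst (λ g → Surcharge U a b (28 * (2 * g))) g3
        (all-white U a b 28 3 2 2 (tm 0 refl) refl ub (λ e k h → table-28 e k (m≤n⇒m≤1+n h)) ua)
    white-surcharge U a b 4 ab ua ub g4 bnd tm _ _ _ _ _ _ _ =
      subst (λ g → Surcharge U a b (28 * (2 * g))) g4
        (all-white U a b 28 3 3 2 (tm 1 refl) refl ub table-28 ua)
    white-surcharge U a b 5 ab ua ub g5 bnd tm _ _ _ _ _ _ _ =
      subst (λ g → Surcharge U a b (20 * (1 * g))) g5
        (all-white U a b 20 4 4 1 (tm 2 refl) refl ub table-20 ua)
    white-surcharge U a b (suc (suc (suc (suc (suc (suc _)))))) _ _ _ _ _ _ r s t _ _ _ _ = no-bonus U a b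

    swap-parts : ∀ r s t → r + s + t ≡ s + (r + t)
    swap-parts r s t = trans (cong (_+ t) (+-comm r s)) (+-assoc s r t)

    gain-parts : ∀ U a b {g} → gain U a b ≡ g → i01 U a b + i10 U a b + i11 U a b ≡ g
    gain-parts U a b e = trans (trans (cong (_+ i11 U a b) (+-comm (i01 U a b) (i10 U a b))) (sym (gain-split U a b))) e

    after : ∀ U a b {x g} k → adj a x ≡ true → (∀ y → cov a y ≡ true → dom a b y ≡ true) →
            gain U a x ≤ g → g ≤ k + p U a → d (U ∖ dom a b) x ≤ k
    after U a b {x} k ax inc h g≤ =
      +-cancelʳ-≤ (p U a) _ k (≤-trans (nbr-bound U (dom a b) ax inc) (≤-trans h g≤))

    after′ : ∀ U a b {x g} k → adj b x ≡ true → gain U b x ≤ g → g ≤ k + p U b → d (U ∖ dom a b) x ≤ k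
    after′ U a b {x} k bx h g≤ =
      +-cancelʳ-≤ (p U b) _ k (≤-trans (nbr-bound U (dom a b) bx (covʳ a b)) (≤-trans h g≤))

    -- As `g` is maximal, `nbr-bound` leaves at most `g - p U a = r` white neighbours to the white
    -- neighbours of `a`, and at most `g - p U b = s` to those of `b`.
    white-done : ∀ U g a b → g ≤ 11 → Bounded U g →
      (∀ k → g ≡ 3 + k → Tame U (3 ⊔ (2 + k)) (2 + k)) →
      adj a b ≡ true → U a ≡ true → U b ≡ true → gain U a b ≡ g → Done U
    white-done U g a b g≤11 bnd tm ab ua ub gain≡g =
      [ (λ enough → drop-done U a b r s ab ub ba bb
            (white-surcharge U a b g ab ua ub gain≡g bnd tm r s t 2≤t parts pa pb) (total enough))
      , (λ (r2 , s2 , t2) → drop-done U a b r s ab ub ba bb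
            (special r2 s2 t2) (total42 r2 s2 t2))
      ]′ (white-enough (≤-component₁ {r} {s} {t} parts g≤11) (≤-component₂ {r} {s} {t} parts g≤11)
            (≤-component₃ {r} {s} {t} parts g≤11) 2≤t (≤-trans (≤-reflexive parts) g≤11))
      where
      r = i01 U a b
      s = i10 U a b
      t = i11 U a b
      parts : r + s + t ≡ g
      parts = gain-parts U a b gain≡g
      2≤t = two-ends U a b ab ua ub
      pa : p U a ≡ s + t
      pa = pˡ-split U a b
      pb : p U b ≡ r + t
      pb = pʳ-split U a b
      ga : g ≤ r + p U a
      ga = ≤-reflexive (trans (sym parts) (trans (+-assoc r s t) (cong (r +_) (sym pa))))
      gb : g ≤ s + p U b
      gb = ≤-reflexive (trans (sym parts) (trans (swap-parts r s t) (cong (s +_) (sym pb))))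
      ba : ∀ x → U x ≡ true → adj a x ≡ true → d (U ∖ dom a b) x ≤ r
      ba x ux ax = after U a b r ax (covˡ a b) (bnd a x ax ux) ga
      bb : ∀ x → U x ≡ true → adj b x ≡ true → d (U ∖ dom a b) x ≤ s
      bb x ux bx = after′ U a b s bx (bnd b x bx ux) gb
      ends : ∀ m → endBonus U a m ≡ 350 ∸ m
      ends m rewrite ua = refl
      Total : ℕ → ℕ
      Total bonus = W r * s + W s * r + (W r ⊔ W s) * t
            + ((350 ∸ (W r ⊔ W s)) + endBonus U a (W r ⊔ W s)) + bonus
      total : 1190 ≤ whiteDrop r s t + whiteBonus (r + s + t) → 1190 ≤ Total (whiteBonus g)
      total h rewrite ends (W r ⊔ W s) | sym parts = h
      -- Both ends have `p = 4`, hence at least one blue neighbour each; at 21 apiece they supply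
      -- exactly the missing 42.
      special : r ≡ 2 → s ≡ 2 → t ≡ 2 → Surcharge U a b 42
      special r2 s2 t2 = pair U a b g ab ua ub bnd 21 2 1 r s t parts pa pb (≤-reflexive r2) (≤-reflexive s2)
        (≤-reflexive (cong₂ (λ x y → x + y + 1) s2 t2)) (≤-reflexive (cong₂ (λ x y → x + y + 1) r2 t2))
      total42 : r ≡ 2 → s ≡ 2 → t ≡ 2 → 1190 ≤ Total 42
      total42 r2 s2 t2 rewrite ends (W r ⊔ W s) =
        subst₂ (λ r s → ∀ {t} → t ≡ 2 → 1190 ≤ whiteDrop r s t + 42) (sym r2) (sym s2)
          (λ { refl → m≤m+n 1190 0 }) t2

    -- At gain 5 the white edges gain at most 4, and a white vertex with `p = 4` is then settled by
    -- `closed-white`; the cap 3 gives every white vertex two blue neighbours.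
    blueCap : ℕ → ℕ
    blueCap 5 = 3
    blueCap g = g ∸ 1

    blue-surcharge : ∀ U a b g → U b ≡ true → U a ≡ false → gain U a b ≡ g →
      Tame U (blueCap g) (g ∸ 1) →
      ∀ {q p'} → d U a ≡ q → p U b ≡ p' → Surcharge U a b (blueBonus g q p')
    blue-surcharge U a b 3 ub ua g3 tm refl refl =
      subst (λ g → Surcharge U a b (28 * ((3 * g + (2 ∸ p U b)) ∸ d U a))) g3
        (all-blue U a b 28 2 2 3 tm refl ub (λ e k h → table-28 e k (m≤n⇒m≤1+n h)))
    blue-surcharge U a b 4 ub ua g4 tm refl refl =
      subst (λ g → Surcharge U a b (28 * ((2 * g + (3 ∸ p U b)) ∸ d U a))) g4
        (all-blue U a b 28 3 3 2 tm refl ub table-28)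
    blue-surcharge U a b 5 ub ua g5 tm refl refl =
      subst (λ g → Surcharge U a b (20 * ((2 * g + (3 ∸ p U b)) ∸ d U a))) g5
        (all-blue U a b 20 3 4 2 tm refl ub table-20)
    blue-surcharge U a b 0 _ _ _ _ _ _ = no-bonus U a b
    blue-surcharge U a b 1 _ _ _ _ _ _ = no-bonus U a b
    blue-surcharge U a b 2 _ _ _ _ _ _ = no-bonus U a b
    blue-surcharge U a b (suc (suc (suc (suc (suc (suc _)))))) _ _ _ _ _ _ = no-bonus U a b

    tame-blue : ∀ U k → Bounded U (3 + k) → WhiteBounded U (2 + k) →
                Done U ⊎ Tame U (blueCap (3 + k)) (2 + k)
    tame-blue U k bnd wb = tame (whites k wb) (blues-below U (2 + k) (m≤m+n 2 k) bnd)
      where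
      below : ∀ {g} → 1 ≤ g → WhiteBounded U g → Done U ⊎ (∀ y → U y ≡ true → p U y ≤ g)
      below h wb = inj₂ λ y → p≤ U h wb
      whites : ∀ k → WhiteBounded U (2 + k) → Done U ⊎ (∀ y → U y ≡ true → p U y ≤ blueCap (3 + k))
      whites 0 wb = below (s≤s z≤n) wb
      whites 1 wb = below (s≤s z≤n) wb
      whites 2 wb = whites-below U 3 ≤-refl wb
      whites (suc (suc (suc k))) wb = below (s≤s z≤n) wb

    blueCap<g : ∀ k → blueCap (3 + k) < 3 + k
    blueCap<g 0 = ≤-refl
    blueCap<g 1 = ≤-refl
    blueCap<g 2 = m≤m+n 4 1
    blueCap<g (suc (suc (suc k))) = ≤-refl

    one-end : ∀ U a b → adj a b ≡ true → U b ≡ true → 1 ≤ i11 U a b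
    one-end U a b ab ub = ∈⇒1≤# (λ x → U x ∧ cov a x ∧ cov b x) {b} (true-∧ ub (true-∧ (adj⇒cov ab) (cov-self b)))

    positive-part : ∀ {x y z g} → x + y ≡ g → y ≡ z → z < g → 1 ≤ x
    positive-part {zero} refl refl h = ⊥-elim (<-irrefl refl h)
    positive-part {suc x} _ _ _ = s≤s z≤n

    -- `Tame` keeps `p U a` and `p U b` below the gain, so `r` and `s` are positive. As `b` is
    -- white, its edges to white vertices gain at most `2 + k`, which improves the bound on that
    -- side to `s ∸ 1`.
    blue-done : ∀ U k a b → 3 + k ≤ 11 → Bounded U (3 + k) → WhiteBounded U (2 + k) →
      Tame U (blueCap (3 + k)) (2 + k) →
      adj a b ≡ true → U a ≡ false → U b ≡ true → gain U a b ≡ 3 + k → Done U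
    blue-done U k a b g≤11 bnd wb tm ab ua ub gain≡g =
      drop-done U a b r (s ∸ 1) ab ub ba bb
        (blue-surcharge U a b g ub ua gain≡g tm qa pb)
        (total (blue-enough (≤-component₁ {r} {s} {t} parts g≤11) (≤-component₂ {r} {s} {t} parts g≤11)
            (≤-component₃ {r} {s} {t} parts g≤11) 1≤r 1≤s (one-end U a b ab ub)
            (≤-trans (m≤m+n 3 k) (≤-reflexive (sym parts))) (≤-trans (≤-reflexive parts) g≤11)))
      where
      g = 3 + k
      r = i01 U a b
      s = i10 U a b
      t = i11 U a b
      parts : r + s + t ≡ g
      parts = gain-parts U a b gain≡g
      pa : p U a ≡ s + t
      pa = pˡ-split U a b
      qa : d U a ≡ s + t
      qa = trans (sym (p-blue U ua)) pa
      pb : p U b ≡ r + t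
      pb = pʳ-split U a b
      1≤r : 1 ≤ r
      1≤r = positive-part (trans (sym (+-assoc r s t)) parts) (sym qa) (s≤s (Tame.blue tm a ua))
      1≤s : 1 ≤ s
      1≤s = positive-part (trans (sym (swap-parts r s t)) parts) (sym pb)
              (≤-<-trans (Tame.white tm b ub) (blueCap<g k))
      ga : g ≤ r + p U a
      ga = ≤-reflexive (trans (sym parts) (trans (+-assoc r s t) (cong (r +_) (sym pa))))
      gb : 2 + k ≤ (s ∸ 1) + p U b
      gb = ≤-pred (≤-trans (≤-reflexive (trans (sym parts) (trans (swap-parts r s t) (cong (s +_) (sym pb)))))
             (+-monoˡ-≤ (p U b) (m≤n+m∸n s 1)))
      ba : ∀ x → U x ≡ true → adj a x ≡ true → d (U ∖ dom a b) x ≤ r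
      ba x ux ax = after U a b r ax (covˡ a b) (bnd a x ax ux) ga
      bb : ∀ x → U x ≡ true → adj b x ≡ true → d (U ∖ dom a b) x ≤ s ∸ 1
      bb x ux bx = after′ U a b (s ∸ 1) bx (wb b x bx ub ux) gb
      ends : ∀ m → endBonus U a m ≡ β (s + t)
      ends m rewrite ua = cong β qa
      m′ = W r ⊔ W (s ∸ 1)
      total : 1190 ≤ blueDrop r s t + blueBonus (r + s + t) (s + t) (r + t) →
              1190 ≤ W r * s + W (s ∸ 1) * r + m′ * t + ((350 ∸ m′) + endBonus U a m′) + blueBonus g (s + t) (r + t)
      total h rewrite ends m′ | sym parts = h

    -- Descent on the largest gain, down to the sparse phase

    Sparse : (Fin n → Bool) → Set
    Sparse U = (∀ x y → adj x y ≡ true → U x ≡ true → U y ≡ false) × (∀ z → U z ≡ false → d U z ≤ 2)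

    -- The colour of `a` is a parameter, so that edges with two white ends can be settled before
    -- those with a blue end.
    improve : ∀ (kind : Fin n → Bool) U g →
      (∀ a b → adj a b ≡ true → kind a ≡ true → U b ≡ true → gain U a b ≤ suc g) →
      (∀ a b → adj a b ≡ true → kind a ≡ true → U b ≡ true → gain U a b ≡ suc g → Done U) →
      Done U ⊎ (∀ a b → adj a b ≡ true → kind a ≡ true → U b ≡ true → gain U a b ≤ g)
    improve kind U g bnd attained = Sum.map₂
      (λ none a b ab ka ub → ≤-pred (≤∧≢⇒< (bnd a b ab ka ub) λ e → none a (b , ab , ka , ub , e)))
      (search (λ a → any? λ b → (adj a b Bool.≟ true) ×-dec ((kind a Bool.≟ true) ×-dec
          ((U b Bool.≟ true) ×-dec (gain U a b ≟ℕ suc g))))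
        (λ a (b , ab , ka , ub , e) → attained a b ab ka ub e))

    glue : ∀ {U g} → WhiteBounded U g →
           (∀ a b → adj a b ≡ true → not (U a) ≡ true → U b ≡ true → gain U a b ≤ g) → Bounded U g
    glue {U} wb bb a b ab ub = case′ (true? (U a))
      where
      case′ : U a ≡ true ⊎ U a ≡ false → _
      case′ (inj₁ ua) = wb a b ab ua ub
      case′ (inj₂ ua) = bb a b ab (cong not ua) ub

    -- White edges of gain `3 + k` come first. Once there are none, the sharper `WhiteBounded` is
    -- available for the edges with a blue end.
    descend : ∀ U k → 3 + k ≤ 11 → Bounded U (3 + k) → Done U ⊎ Bounded U (2 + k)
    descend U k g≤11 bnd = [ inj₁ , (λ tm → [ inj₁ , blues ]′ (whites tm)) ]′ (tame-white U k bnd)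
      where
      whites : Tame U (3 ⊔ (2 + k)) (2 + k) → Done U ⊎ WhiteBounded U (2 + k)
      whites tm = improve U U (2 + k) (whiteBounded bnd)
        λ a b ab ua ub e → white-done U (3 + k) a b g≤11 bnd (λ { _ refl → tm }) ab ua ub e
      blues : WhiteBounded U (2 + k) → Done U ⊎ Bounded U (2 + k)
      blues wb = [ inj₁ , (λ tm → Sum.map₂ (glue {U} wb)
          (improve (λ a → not (U a)) U (2 + k) (λ a b ab _ ub → bnd a b ab ub)
            λ a b ab ka ub e → blue-done U k a b g≤11 bnd wb tm ab (not-true ka) ub e)) ]′
        (tame-blue U k bnd wb)
        where
        not-true : ∀ {u} → not u ≡ true → u ≡ false
        not-true {false} _ = refl

    -- An edge between white vertices gains at least 2, by its ends. Once those of gain 2 are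
    -- settled there is none, so the white vertices are independent.
    sparse : ∀ U → Bounded U 2 → Done U ⊎ Sparse U
    sparse U bnd = Sum.map₂ conclude (improve U U 1 (whiteBounded bnd)
        λ a b ab ua ub e → white-done U 2 a b (m≤m+n 2 9) bnd (λ _ ()) ab ua ub e)
      where
      conclude : WhiteBounded U 1 → Sparse U
      conclude wb = (λ x y xy ux → [ (λ uy → ⊥-elim (1+n≰n (edge xy ux uy))) , id ]′ (true? (U y)))
                  , λ z uz → d≤ U bnd uz
        where
        edge : ∀ {x y} → adj x y ≡ true → U x ≡ true → U y ≡ true → 2 ≤ 1
        edge {x} {y} xy ux uy = ≤-trans (≤-trans (two-ends U x y xy ux uy)
          (≤-trans (m≤n+m (i11 U x y) (i10 U x y)) (≤-reflexive (sym (pˡ-split U x y)))))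
          (≤-trans (p≤gain U x y) (wb x y xy ux uy))

    descent : ∀ U k → 2 + k ≤ 11 → Bounded U (2 + k) → Done U ⊎ Sparse U
    descent U zero _ bnd = sparse U bnd
    descent U (suc k) h bnd = [ inj₁ , descent U k (≤-trans (n≤1+n _) h) ]′ (descend U k h bnd)

    -- Gains from 12 on are settled by `huge`, so the descent starts at `2 + 9 = 11`.
    dense-or-sparse : ∀ U → Done U ⊎ Sparse U
    dense-or-sparse U = [ inj₁ , (λ none → descent U 9 ≤-refl λ a b ab ub →
        ≮⇒≥ λ h → none a (b , ab , ub , h)) ]′
      (search (λ a → any? λ b → (adj a b Bool.≟ true) ×-dec ((U b Bool.≟ true) ×-dec (12 ≤? gain U a b)))
        (λ a (b , ab , ub , h) → huge U a b ab ub h))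

    -- The potential of the sparse phase

    one two : ℕ → ℕ
    one 1 = 1
    one _ = 0
    two 2 = 1
    two _ = 0

    -- In the sparse phase a white vertex weighs more, at an increasing rate, the more of its
    -- neighbours have no other white neighbour; the weight of the others is split in halves.
    f : ℕ → ℕ
    f 0 = 350
    f 1 = 540
    f 2 = 740
    f 3 = 965
    f (suc (suc (suc (suc _)))) = 1190

    -- For a white `u` in the sparse phase, `j` counts its private blue neighbours, and `m` is its
    -- degree in the multigraph whose edges are the blue vertices with two white neighbours.
    j m : (Fin n → Bool) → Fin n → ℕ
    j U u = ∑ (λ z → ⟦ adj u z ⟧ * one (d U z))
    m U u = ∑ (λ z → ⟦ adj u z ⟧ * two (d U z))

    -- The factor 119 is half of `β 2`.
    F : (Fin n → Bool) → Fin n → ℕ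
    F U u = f (j U u) + 119 * m U u

    Ψ : (Fin n → Bool) → ℕ
    Ψ U = ∑ (λ u → ⟦ U u ⟧ * F U u)

    ∑-adj-swap : ∀ (S : Fin n → Bool) (h : Fin n → ℕ) →
      ∑ (λ u → ⟦ S u ⟧ * ∑ (λ z → ⟦ adj u z ⟧ * h z)) ≡ ∑ (λ z → h z * d S z)
    ∑-adj-swap S h =
      trans (∑-cong λ u → sym (∑-* ⟦ S u ⟧ (λ z → ⟦ adj u z ⟧ * h z)))
      (trans (∑-swap (λ u z → ⟦ S u ⟧ * (⟦ adj u z ⟧ * h z)))
      (∑-cong λ z → trans (∑-cong λ u → flip u z) (∑-* (h z) (λ u → ⟦ adj z u ∧ S u ⟧))))
      where
      swap : ∀ s e h → ⟦ s ⟧ * (⟦ e ⟧ * h) ≡ h * ⟦ e ∧ s ⟧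
      swap false false h = sym (*-zeroʳ h)
      swap false true h = sym (*-zeroʳ h)
      swap true false h = sym (*-zeroʳ h)
      swap true true h = trans (+-identityʳ (h + 0)) (trans (+-identityʳ h) (sym (*-identityʳ h)))
      flip : ∀ u z → ⟦ S u ⟧ * (⟦ adj u z ⟧ * h z) ≡ h z * ⟦ adj z u ∧ S u ⟧
      flip u z rewrite adj-sym u z = swap (S u) (adj z u) (h z)

    d≡0 : ∀ U {z} → (∀ y → adj z y ≡ true → U y ≡ false) → d U z ≡ 0
    d≡0 U {z} h = ∑-zero λ y → none′ y (true? (adj z y))
      where
      none′ : ∀ y → adj z y ≡ true ⊎ adj z y ≡ false → ⟦ adj z y ∧ U y ⟧ ≡ 0
      none′ y (inj₁ e) rewrite h y e | e = refl
      none′ y (inj₂ e) rewrite e = refl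

    sparse-white : ∀ {U} → Sparse U → ∀ {z} → U z ≡ true → d U z ≡ 0
    sparse-white {U} (indep , _) {z} uz = d≡0 U λ y zy → indep z y zy uz

    f-linear : ∀ k → f k ≤ 350 + 210 * k
    f-linear 0 = ≤-refl
    f-linear 1 = m≤m+n 540 20
    f-linear 2 = m≤m+n 740 30
    f-linear 3 = m≤m+n 965 15
    f-linear (suc (suc (suc (suc k)))) = +-monoʳ-≤ 350 (*-monoʳ-≤ 210 {4} {4 + k} (m≤m+n 4 k))

    -- Each blue vertex hands its weight to its white neighbours: 210 to a single one, 119 to each
    -- of two. A white vertex then holds `350 + 210 * j + 119 * m`, which is at least `F` by
    -- `f-linear`.
    Ψ≤Φ : ∀ U → Sparse U → Ψ U ≤ Φ U
    Ψ≤Φ U sp = begin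
      Ψ U ≤⟨ ∑-mono (λ u → *-monoʳ-≤ ⟦ U u ⟧ (F≤ u)) ⟩
      ∑ (λ u → ⟦ U u ⟧ * (350 + share u)) ≡⟨ ∑-cong (λ u → *-distribˡ-+ ⟦ U u ⟧ 350 (share u)) ⟩
      ∑ (λ u → ⟦ U u ⟧ * 350 + ⟦ U u ⟧ * share u) ≡⟨ ∑-+ {n} (λ u → ⟦ U u ⟧ * 350) (λ u → ⟦ U u ⟧ * share u) ⟩
      ∑ (λ u → ⟦ U u ⟧ * 350) + ∑ (λ u → ⟦ U u ⟧ * share u) ≡⟨ cong (∑ (λ u → ⟦ U u ⟧ * 350) +_) (∑-adj-swap U h) ⟩
      ∑ (λ u → ⟦ U u ⟧ * 350) + ∑ (λ z → h z * d U z) ≡⟨ ∑-+ {n} (λ u → ⟦ U u ⟧ * 350) (λ z → h z * d U z) ⟨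
      ∑ (λ z → ⟦ U z ⟧ * 350 + h z * d U z) ≤⟨ ∑-mono local ⟩
      Φ U ∎
      where
      open ≤-Reasoning
      w : ℕ → ℕ
      w k = 210 * one k + 119 * two k
      h : Fin n → ℕ
      h z = w (d U z)
      share : Fin n → ℕ
      share u = ∑ (λ z → ⟦ adj u z ⟧ * h z)
      spread : ∀ u → share u ≡ 210 * j U u + 119 * m U u
      spread u = trans (∑-cong λ z → expand ⟦ adj u z ⟧ (one (d U z)) (two (d U z)))
        (trans (∑-+ {n} (λ z → 210 * (⟦ adj u z ⟧ * one (d U z))) (λ z → 119 * (⟦ adj u z ⟧ * two (d U z))))
          (cong₂ _+_ (∑-* 210 (λ z → ⟦ adj u z ⟧ * one (d U z))) (∑-* 119 (λ z → ⟦ adj u z ⟧ * two (d U z)))))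
        where
        assoc′ : ∀ a c x → a * (c * x) ≡ c * (a * x)
        assoc′ a c x = trans (sym (*-assoc a c x)) (trans (cong (_* x) (*-comm a c)) (*-assoc c a x))
        expand : ∀ a x y → a * (210 * x + 119 * y) ≡ 210 * (a * x) + 119 * (a * y)
        expand a x y = trans (*-distribˡ-+ a (210 * x) (119 * y)) (cong₂ _+_ (assoc′ a 210 x) (assoc′ a 119 y))
      F≤ : ∀ u → F U u ≤ 350 + share u
      F≤ u = ≤-trans (+-monoˡ-≤ (119 * m U u) (f-linear (j U u)))
        (≤-reflexive (trans (+-assoc 350 (210 * j U u) (119 * m U u)) (cong (350 +_) (sym (spread u)))))
      small : ∀ k → k ≤ 2 → w k * k ≤ β k
      small 0 _ = z≤n
      small 1 _ = ≤-refl
      small 2 _ = ≤-refl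
      small (suc (suc (suc _))) (s≤s (s≤s ()))
      local : ∀ z → ⟦ U z ⟧ * 350 + h z * d U z ≤ φ (U z) (d U z)
      local z with U z in uz
      ... | true rewrite sparse-white sp uz = ≤-refl
      ... | false = small (d U z) (proj₂ sp z uz)

    SparseDone : (Fin n → Bool) → Set
    SparseDone U = ∃[ a ] ∃[ b ] (adj a b ≡ true × U a ≡ true × Ψ (U ∖ dom a b) + 1190 ≤ Ψ U)

    -- For white vertices in the sparse phase this is the multiplicity of the edge `xy` of the
    -- multigraph.
    common : Fin n → Fin n → ℕ
    common x y = ∑ (λ z → ⟦ adj x z ⟧ * ⟦ adj z y ⟧)

    -- The drop of the second potential caused by one edge

    module SparseStep (U : Fin n → Bool) (sp : Sparse U) (a b : Fin n)
      (ab : adj a b ≡ true) (ua : U a ≡ true) where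

      U' R : Fin n → Bool
      U' = U ∖ dom a b
      R = removed U a b

      -- For a surviving `s`, the number of multigraph edges from `s` to removed vertices.
      k : Fin n → ℕ
      k s = ∑ (λ z → ⟦ adj s z ⟧ * d R z)

      d≤2 : ∀ z → d U z ≤ 2
      d≤2 z = [ (λ uz → ≤-trans (≤-reflexive (sparse-white sp uz)) z≤n) , proj₂ sp z ]′ (true? (U z))

      d'+dR≤2 : ∀ z → d U' z + d R z ≤ 2
      d'+dR≤2 z = ≤-trans (≤-reflexive (sym (d-split U (dom a b) z))) (d≤2 z)

      -- A blue neighbour of the surviving `s` still has `s` as a white neighbour, so it can lose at
      -- most one, and then it becomes private to `s`. In `m-shrinks` the same vertices leave `m`.
      j-grows : ∀ s → U' s ≡ true → j U' s ≡ j U s + k s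
      j-grows s us = trans (∑-cong local) (∑-+ {n} (λ z → ⟦ adj s z ⟧ * one (d U z)) (λ z → ⟦ adj s z ⟧ * d R z))
        where
        table : ∀ x y → 1 ≤ x → x + y ≤ 2 → one x + 0 ≡ one (x + y) + 0 + (y + 0)
        table 1 0 _ _ = refl
        table 1 1 _ _ = refl
        table 2 0 _ _ = refl
        table 1 (suc (suc _)) _ (s≤s (s≤s ()))
        table (suc (suc (suc _))) _ _ (s≤s (s≤s ()))
        table (suc (suc zero)) (suc _) _ (s≤s (s≤s ()))
        local : ∀ z → ⟦ adj s z ⟧ * one (d U' z) ≡ ⟦ adj s z ⟧ * one (d U z) + ⟦ adj s z ⟧ * d R z
        local z rewrite d-split U (dom a b) z with adj s z in sz
        ... | false = refl
        ... | true = table (d U' z) (d R z) (nbr-d U' (adj-comm sz) us) (d'+dR≤2 z)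

      m-shrinks : ∀ s → U' s ≡ true → m U s ≡ m U' s + k s
      m-shrinks s us = trans (∑-cong local) (∑-+ {n} (λ z → ⟦ adj s z ⟧ * two (d U' z)) (λ z → ⟦ adj s z ⟧ * d R z))
        where
        table : ∀ x y → 1 ≤ x → x + y ≤ 2 → two (x + y) + 0 ≡ two x + 0 + (y + 0)
        table 1 0 _ _ = refl
        table 1 1 _ _ = refl
        table 2 0 _ _ = refl
        table 1 (suc (suc _)) _ (s≤s (s≤s ()))
        table (suc (suc (suc _))) _ _ (s≤s (s≤s ()))
        table (suc (suc zero)) (suc _) _ (s≤s (s≤s ()))
        local : ∀ z → ⟦ adj s z ⟧ * two (d U z) ≡ ⟦ adj s z ⟧ * two (d U' z) + ⟦ adj s z ⟧ * d R z
        local z rewrite d-split U (dom a b) z with adj s z in sz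
        ... | false = refl
        ... | true = table (d U' z) (d R z) (nbr-d U' (adj-comm sz) us) (d'+dR≤2 z)

      shared : ℕ
      shared = ∑ (λ z → two (d R z))

      -- In the sum of the degrees of removed vertices, an edge leaving `R` is counted once and an
      -- edge inside `R` twice.
      links : ∑ (λ s → ⟦ U' s ⟧ * k s) + 2 * shared ≤ ∑ (λ s → ⟦ R s ⟧ * m U s)
      links = begin
        ∑ (λ s → ⟦ U' s ⟧ * k s) + 2 * shared
          ≡⟨ cong₂ _+_ (∑-adj-swap U' (d R)) (sym (∑-* 2 (λ z → two (d R z)))) ⟩
        ∑ (λ z → d R z * d U' z) + ∑ (λ z → 2 * two (d R z))
          ≡⟨ ∑-+ {n} (λ z → d R z * d U' z) (λ z → 2 * two (d R z)) ⟨
        ∑ (λ z → d R z * d U' z + 2 * two (d R z))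
          ≤⟨ ∑-mono local ⟩
        ∑ (λ z → two (d U z) * d R z)
          ≡⟨ ∑-adj-swap R (λ z → two (d U z)) ⟨
        ∑ (λ s → ⟦ R s ⟧ * m U s) ∎
        where
        open ≤-Reasoning
        table : ∀ x y → x + y ≤ 2 → y * x + 2 * two y ≤ two (x + y) * y
        table 0 0 _ = z≤n
        table 0 1 _ = z≤n
        table 0 2 _ = ≤-refl
        table 1 0 _ = z≤n
        table 1 1 _ = ≤-refl
        table 2 0 _ = z≤n
        table 0 (suc (suc (suc _))) (s≤s (s≤s ()))
        table 1 (suc (suc _)) (s≤s (s≤s ()))
        table (suc (suc zero)) (suc _) (s≤s (s≤s ()))
        table (suc (suc (suc _))) _ (s≤s (s≤s ()))
        local : ∀ z → d R z * d U' z + 2 * two (d R z) ≤ two (d U z) * d R z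
        local z rewrite d-split U (dom a b) z = table (d U' z) (d R z) (d'+dR≤2 z)

      -- Each link (a blue vertex with one white neighbour in R and one outside) costs the white
      -- vertex outside at most κ; the vertices of R have a half weight of 119 per link to cover it.
      module Payment (κ κ′ : ℕ) (κ+κ′ : κ + κ′ ≡ 119)
        (growth : ∀ s → U' s ≡ true → f (j U s + k s) ≤ f (j U s) + (119 * k s + κ * k s))
        (paid : 1190 ≤ ∑ (λ s → ⟦ R s ⟧ * (f (j U s) + κ′ * m U s)) + κ * (2 * shared)) where

        -- Per link the term `119 * m` gives up 119, while `growth` lets `f` rise by at most
        -- `119 + κ`.
        keep : ∀ s → U' s ≡ true → F U' s ≤ F U s + κ * k s
        keep s us = begin
          F U' s
            ≡⟨ cong (λ x → f x + 119 * m U' s) (j-grows s us) ⟩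
          f (j U s + k s) + 119 * m U' s
            ≤⟨ +-monoˡ-≤ (119 * m U' s) (growth s us) ⟩
          f (j U s) + (119 * k s + κ * k s) + 119 * m U' s
            ≡⟨ rearrange 119 (f (j U s)) κ (k s) (m U' s) ⟩
          f (j U s) + 119 * (m U' s + k s) + κ * k s
            ≡⟨ cong (λ x → f (j U s) + 119 * x + κ * k s) (m-shrinks s us) ⟨
          F U s + κ * k s ∎
          where
          open ≤-Reasoning
          rearrange : ∀ c x κ k m → x + (c * k + κ * k) + c * m ≡ x + c * (m + k) + κ * k
          rearrange = solve-∀

        A B K M : ℕ
        A = ∑ (λ s → ⟦ U' s ⟧ * F U s)
        B = ∑ (λ s → ⟦ R s ⟧ * (f (j U s) + κ′ * m U s))
        K = ∑ (λ s → ⟦ U' s ⟧ * k s)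
        M = ∑ (λ s → ⟦ R s ⟧ * m U s)

        new : Ψ U' ≤ A + κ * K
        new = ≤-trans (∑-mono local) (≤-reflexive (trans
            (∑-+ {n} (λ s → ⟦ U' s ⟧ * F U s) (λ s → κ * (⟦ U' s ⟧ * k s)))
            (cong (A +_) (∑-* κ (λ s → ⟦ U' s ⟧ * k s)))))
          where
          local : ∀ s → ⟦ U' s ⟧ * F U' s ≤ ⟦ U' s ⟧ * F U s + κ * (⟦ U' s ⟧ * k s)
          local s with U' s in us
          ... | false = z≤n
          ... | true rewrite +-identityʳ (F U' s) | +-identityʳ (F U s) | +-identityʳ (k s) = keep s us

        -- The half weight 119 of a removed vertex is split: `κ` per multigraph edge is reserved for
        -- the links, and `κ′` goes towards the 1190.
        old : Ψ U ≡ A + (B + κ * M)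
        old = trans (∑-cong local) (trans
            (∑-+ {n} (λ s → ⟦ U' s ⟧ * F U s) (λ s → ⟦ R s ⟧ * (f (j U s) + κ′ * m U s) + κ * (⟦ R s ⟧ * m U s)))
            (cong (A +_) (trans (∑-+ {n} (λ s → ⟦ R s ⟧ * (f (j U s) + κ′ * m U s)) (λ s → κ * (⟦ R s ⟧ * m U s)))
              (cong (B +_) (∑-* κ (λ s → ⟦ R s ⟧ * m U s))))))
          where
          rearrange : ∀ x κ κ′ m → x + (κ + κ′) * m ≡ x + κ′ * m + κ * m
          rearrange = solve-∀
          whole : ∀ s → F U s ≡ f (j U s) + κ′ * m U s + κ * m U s
          whole s = trans (sym (cong half {x = κ + κ′} {y = 119} κ+κ′)) (rearrange (f (j U s)) κ κ′ (m U s))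
            where
            half : ℕ → ℕ
            half c = f (j U s) + c * m U s
          local : ∀ s → ⟦ U s ⟧ * F U s ≡
                  ⟦ U' s ⟧ * F U s + (⟦ R s ⟧ * (f (j U s) + κ′ * m U s) + κ * (⟦ R s ⟧ * m U s))
          local s = split (U s) (dom a b s) (F U s) (f (j U s) + κ′ * m U s) (m U s) (whole s)
            where
            split : ∀ u c w v x → w ≡ v + κ * x →
                    ⟦ u ⟧ * w ≡ ⟦ u ∧ not c ⟧ * w + (⟦ u ∧ c ⟧ * v + κ * (⟦ u ∧ c ⟧ * x))
            split false c w v x e = sym (*-zeroʳ κ)
            split true false w v x e = trans (sym (+-identityʳ (w + 0))) (cong (w + 0 +_) (sym (*-zeroʳ κ)))
            split true true w v x e = trans (+-identityʳ w)
              (trans e (sym (cong₂ _+_ (+-identityʳ v) (cong (κ *_) (+-identityʳ x)))))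

        done : SparseDone U
        done = a , b , ab , ua , (begin
          Ψ U' + 1190 ≤⟨ +-mono-≤ new paid ⟩
          A + κ * K + (B + κ * (2 * shared)) ≡⟨ rearrange A κ K B (2 * shared) ⟩
          A + (B + κ * (K + 2 * shared)) ≤⟨ +-monoʳ-≤ A (+-monoʳ-≤ B (*-monoʳ-≤ κ links)) ⟩
          A + (B + κ * M) ≡⟨ old ⟨
          Ψ U ∎)
          where
          open ≤-Reasoning
          rearrange : ∀ A κ K B x → A + κ * K + (B + κ * x) ≡ A + (B + κ * (K + x))
          rearrange = solve-∀

    -- All neighbours of a white vertex are blue, and each has one or two white neighbours, so it is
    -- counted in `j` or in `m`.
    degree-split : ∀ {U} → Sparse U → ∀ {u} → U u ≡ true → 4 ≤ j U u + m U u
    degree-split {U} sp {u} uu = ≤-trans (deg≥4 u) (≤-trans (∑-mono local)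
      (≤-reflexive (∑-+ {n} (λ z → ⟦ adj u z ⟧ * one (d U z)) (λ z → ⟦ adj u z ⟧ * two (d U z)))))
      where
      table : ∀ k → 1 ≤ k → k ≤ 2 → 1 ≤ one k + 0 + (two k + 0)
      table 1 _ _ = ≤-refl
      table 2 _ _ = ≤-refl
      table (suc (suc (suc _))) _ (s≤s (s≤s ()))
      local : ∀ z → ⟦ adj u z ⟧ ≤ ⟦ adj u z ⟧ * one (d U z) + ⟦ adj u z ⟧ * two (d U z)
      local z with adj u z in uz
      ... | false = z≤n
      ... | true = table (d U z) (nbr-d U (adj-comm uz) uu) (proj₂ sp z (proj₁ sp u z uz uu))

    f-step : ∀ i → f (suc i) ≤ f i + 225
    f-step 0 = m≤m+n 540 35
    f-step 1 = m≤m+n 740 25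
    f-step 2 = ≤-refl
    f-step 3 = ≤-refl
    f-step (suc (suc (suc (suc _)))) = m≤m+n 1190 225

    -- The largest increment of `f` is `225 = 119 + 106`, so `κ = 106` works for every `j`.
    f-growth : ∀ x k → f (x + k) ≤ f x + (119 * k + 106 * k)
    f-growth x k = ≤-trans (go k) (≤-reflexive (cong (f x +_) (*-distribʳ-+ k 119 106)))
      where
      go : ∀ k → f (x + k) ≤ f x + 225 * k
      go zero rewrite +-identityʳ x = m≤m+n (f x) _
      go (suc k) rewrite +-suc x k = ≤-trans (f-step (x + k)) (≤-trans (+-monoˡ-≤ 225 (go k))
        (≤-reflexive (trans (+-assoc (f x) (225 * k) 225)
          (cong (f x +_) (trans (+-comm (225 * k) 225) (sym (*-suc 225 k)))))))

    module Pair (U : Fin n → Bool) (sp : Sparse U) (u t w : Fin n) (u≢t : u ≢ t)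
      (uw : adj u w ≡ true) (tw : adj t w ≡ true) (uu : U u ≡ true) (ut : U t ≡ true) where
      open SparseStep U sp u w uw uu public

      both⊆R : ∀ x → both u t x ≡ true → R x ≡ true
      both⊆R x e = cases (x ≟ u) e
        where
        cases : Dec (x ≡ u) → both u t x ≡ true → R x ≡ true
        cases (yes refl) _ = true-∧ uu (covˡ u w x (cov-self x))
        cases (no x≢u) e rewrite ==-≢ x≢u with ==⇒≡ {x = x} e
        ... | refl = true-∧ ut (∨-introʳ {adj u x} (adj⇒cov (adj-comm tw)))

      -- The edge `uw` removes both `u` and `t`, so their common blue neighbours have no surviving
      -- white neighbour.
      shared≥common : common u t ≤ shared
      shared≥common = ∑-mono local
        where
        table : ∀ k → 2 ≤ k → k ≤ 2 → 1 ≤ two k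
        table 2 _ _ = ≤-refl
        table 1 (s≤s ()) _
        table (suc (suc (suc _))) _ (s≤s (s≤s ()))
        local : ∀ z → ⟦ adj u z ⟧ * ⟦ adj z t ⟧ ≤ two (d R z)
        local z with adj u z in uz | adj z t in zt
        ... | false | _ = z≤n
        ... | true | false = z≤n
        ... | true | true = table (d R z)
          (≤-trans (≤-reflexive (sym (trans (d-both u≢t z) (cong₂ (λ x y → ⟦ x ⟧ + ⟦ y ⟧) (adj-comm uz) zt))))
                   (d-mono both⊆R z))
          (≤-trans (m≤n+m (d R z) (d U' z)) (d'+dR≤2 z))

      two-terms : ∀ (v : Fin n → ℕ) → v u + v t ≤ ∑ (λ s → ⟦ R s ⟧ * v s)
      two-terms v = ≤-trans (≤-reflexive (sym (∑-both u≢t v)))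
        (∑-mono λ x → imp (both⊆R x))
        where
        imp : ∀ {a b w} → (a ≡ true → b ≡ true) → ⟦ a ⟧ * w ≤ ⟦ b ⟧ * w
        imp {false} h = z≤n
        imp {true} h rewrite h refl = ≤-refl

      pair-done : ∀ κ κ′ (κ+κ′ : κ + κ′ ≡ 119) →
        (∀ s → U' s ≡ true → f (j U s + k s) ≤ f (j U s) + (119 * k s + κ * k s)) →
        ∀ c → c ≤ common u t →
        1190 ≤ (f (j U u) + κ′ * m U u) + (f (j U t) + κ′ * m U t) + κ * (2 * c) → SparseDone U
      pair-done κ κ′ κ+κ′ growth c c≤ enough = Payment.done κ κ′ κ+κ′ growth
        (≤-trans enough (+-mono-≤ (two-terms (λ s → f (j U s) + κ′ * m U s))
          (*-monoʳ-≤ κ (*-monoʳ-≤ 2 (≤-trans c≤ shared≥common)))))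

    common-pos : ∀ {u t w} → adj u w ≡ true → adj t w ≡ true → 1 ≤ common u t
    common-pos {u} {t} {w} uw tw =
      ≤-trans (≤-reflexive (sym (cong₂ (λ x y → ⟦ x ⟧ * ⟦ y ⟧) uw (adj-comm tw))))
        (term≤∑ (λ z → ⟦ adj u z ⟧ * ⟦ adj z t ⟧) w)

    second-white : ∀ U {u w} → U u ≡ true → d U w ≡ 2 → ∃[ t ] (u ≢ t × adj t w ≡ true × U t ≡ true)
    second-white U {u} {w} uu dw = found (#-pos q (≤-pred (≤-trans (≤-reflexive (sym dw)) (≤-trans (∑-mono local)
        (≤-reflexive (trans (∑-+ {n} (λ y → ⟦ y == u ⟧ * 1) (λ y → ⟦ q y ⟧)) (cong (_+ # q) (∑-δ u (λ _ → 1)))))))))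
      where
      q : Fin n → Bool
      q y = (adj w y ∧ U y) ∧ not (y == u)
      local : ∀ y → ⟦ adj w y ∧ U y ⟧ ≤ ⟦ y == u ⟧ * 1 + ⟦ q y ⟧
      local y with adj w y ∧ U y | y == u
      ... | false | _ = z≤n
      ... | true | true = ≤-refl
      ... | true | false = ≤-refl
      found : ∃[ t ] (q t ≡ true) → ∃[ t ] (u ≢ t × adj t w ≡ true × U t ≡ true)
      found (t , e) = let (wt , h) = ∧-true {adj w t ∧ U t} e ; (w~t , ut) = ∧-true {adj w t} wt in
        t , (λ { refl → true≢false {not (t == t)} h (cong not (==-refl t)) }) , adj-comm w~t , ut

    -- Choice of the edge in the sparse phase

    module SparseCases (U : Fin n → Bool) (sp : Sparse U) where

      -- The extreme case is `j = 0`, `m = 4`, with `350 + 13 * 4 = 402`. In `heavy` it is `j = 1`,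
      -- `m = 3`, with `540 + 13 * 3 = 579`.
      light : ∀ {u} → U u ≡ true → 402 ≤ f (j U u) + 13 * m U u
      light {u} uu = table (j U u) (m U u) (degree-split sp uu)
        where
        table : ∀ x y → 4 ≤ x + y → 402 ≤ f x + 13 * y
        table 0 y h = +-monoʳ-≤ 350 (*-monoʳ-≤ 13 h)
        table 1 y h = m≤n⇒m≤n+o (13 * y) (m≤m+n 402 138)
        table 2 y h = m≤n⇒m≤n+o (13 * y) (m≤m+n 402 338)
        table 3 y h = m≤n⇒m≤n+o (13 * y) (m≤m+n 402 563)
        table (suc (suc (suc (suc _)))) y h = m≤n⇒m≤n+o (13 * y) (m≤m+n 402 788)

      heavy : ∀ {u} → U u ≡ true → 1 ≤ j U u → 579 ≤ f (j U u) + 13 * m U u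
      heavy {u} uu = table (j U u) (m U u) (degree-split sp uu)
        where
        table : ∀ x y → 4 ≤ x + y → 1 ≤ x → 579 ≤ f x + 13 * y
        table 1 y (s≤s h) _ = +-monoʳ-≤ 540 (*-monoʳ-≤ 13 h)
        table 2 y h _ = m≤n⇒m≤n+o (13 * y) (m≤m+n 579 161)
        table 3 y h _ = m≤n⇒m≤n+o (13 * y) (m≤m+n 579 386)
        table (suc (suc (suc (suc _)))) y h _ = m≤n⇒m≤n+o (13 * y) (m≤m+n 579 611)

      private-pair : ∀ {u} → U u ≡ true → 1 ≤ j U u → ∀ w → adj u w ≡ true × d U w ≡ 2 → SparseDone U
      private-pair {u} uu ju w (uw , dw) = go (second-white U uu dw)
        where
        go : ∃[ t ] (u ≢ t × adj t w ≡ true × U t ≡ true) → SparseDone U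
        go (t , u≢t , tw , ut) = Pr.pair-done 106 13 refl (λ s _ → f-growth (j U s) (Pr.k s)) 1 (common-pos uw tw)
          -- The shared vertex `w` saves `106 * 2 = 212`, and `579 + 402 + 212 = 1193`.
          (≤-trans (m≤m+n 1190 3) (+-monoˡ-≤ 212 (+-mono-≤ (heavy uu ju) (light ut))))
          where module Pr = Pair U sp u t w u≢t uw tw uu ut

      -- All neighbours of `u` are private, at least four, so `f` alone yields 1190.
      private-alone : ∀ {u} → U u ≡ true → (∀ w → ¬ (adj u w ≡ true × d U w ≡ 2)) → SparseDone U
      private-alone {u} uu none′ = go (#-pos (adj u) (≤-trans (m≤m+n 1 3) (deg≥4 u)))
        where
        m≡0 : m U u ≡ 0
        m≡0 = ∑-zero λ z → zero′ z (true? (adj u z))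
          where
          table : ∀ k → k ≢ 2 → two k + 0 ≡ 0
          table 0 h = refl
          table 1 h = refl
          table 2 h = ⊥-elim (h refl)
          table (suc (suc (suc _))) h = refl
          zero′ : ∀ z → adj u z ≡ true ⊎ adj u z ≡ false → ⟦ adj u z ⟧ * two (d U z) ≡ 0
          zero′ z (inj₂ uz) rewrite uz = refl
          zero′ z (inj₁ uz) rewrite uz = table (d U z) λ e → none′ z (uz , e)
        full : ∀ x y → y ≡ 0 → 4 ≤ x + y → 1190 ≤ f x + 13 * y
        full x .0 refl h = ≤-trans (top x (≤-trans h (≤-reflexive (+-identityʳ x)))) (m≤m+n (f x) 0)
          where
          top : ∀ x → 4 ≤ x → 1190 ≤ f x
          top (suc (suc (suc (suc _)))) _ = ≤-refl
          top 1 (s≤s ())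
          top 2 (s≤s (s≤s ()))
          top 3 (s≤s (s≤s (s≤s ())))
        go : ∃[ w ] (adj u w ≡ true) → SparseDone U
        go (w , uw) = St.Payment.done 106 13 refl (λ s _ → f-growth (j U s) (St.k s))
          (≤-trans (full (j U u) (m U u) m≡0 (degree-split sp uu)) (≤-trans one-term (m≤m+n _ _)))
          where
          module St = SparseStep U sp u w uw uu
          v : Fin n → ℕ
          v s = f (j U s) + 13 * m U s
          one-term : v u ≤ ∑ (λ s → ⟦ St.R s ⟧ * v s)
          one-term = ≤-trans (≤-reflexive (sym (trans (cong (λ c → ⟦ c ⟧ * v u)
            (true-∧ uu (covˡ u w u (cov-self u)))) (+-identityʳ (v u))))) (term≤∑ (λ s → ⟦ St.R s ⟧ * v s) u)

      private-done : ∀ u → U u ≡ true × 1 ≤ j U u → SparseDone U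
      private-done u (uu , ju) = [ id , private-alone uu ]′
        (search (λ w → (adj u w Bool.≟ true) ×-dec (d U w ≟ℕ 2)) (private-pair uu ju))

      module NoPrivate (j≡0 : ∀ s → U s ≡ true → j U s ≡ 0) where

        worth : ∀ κ′ {u} → U u ≡ true → 350 + κ′ * 4 ≤ f (j U u) + κ′ * m U u
        worth κ′ {u} uu = table (j U u) (j≡0 u uu) (degree-split sp uu)
          where
          table : ∀ x → x ≡ 0 → 4 ≤ x + m U u → 350 + κ′ * 4 ≤ f x + κ′ * m U u
          table 0 _ h = +-monoʳ-≤ 350 (*-monoʳ-≤ κ′ h)

        growth-at-0 : ∀ κ {s k} → U s ≡ true → f k ≤ 350 + (119 * k + κ * k) →
                      f (j U s + k) ≤ f (j U s) + (119 * k + κ * k)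
        growth-at-0 κ {s} {k} us h = table (j U s) (j≡0 s us)
          where
          table : ∀ x → x ≡ 0 → f (x + k) ≤ f x + (119 * k + κ * k)
          table 0 _ = h

        -- The slope 210 of `f-linear` is `119 + 91`, so `κ = 91` covers any number of links. Each
        -- end yields `350 + 28 * 4 = 462`, and two parallel edges save `91 * 4 = 364`: together
        -- 1288.
        parallel-done : ∀ x y → x ≢ y → U x ≡ true → U y ≡ true → 2 ≤ common x y → SparseDone U
        parallel-done x y x≢y ux uy h = go (∑-pos _ (≤-trans (n≤1+n 1) h))
          where
          split : ∀ a b → 1 ≤ ⟦ a ⟧ * ⟦ b ⟧ → a ≡ true × b ≡ true
          split true true _ = refl , refl
          go : ∃[ w ] (1 ≤ ⟦ adj x w ⟧ * ⟦ adj w y ⟧) → SparseDone U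
          go (w , e) = Pr.pair-done 91 28 refl
              (λ s us → growth-at-0 91 (proj₁ (∧-true {U s} us)) (≤-trans (f-linear (Pr.k s))
                (≤-reflexive (cong (350 +_) (*-distribʳ-+ (Pr.k s) 119 91)))))
              2 h (≤-trans (m≤m+n 1190 98) (+-monoˡ-≤ 364 (+-mono-≤ (worth 28 ux) (worth 28 uy))))
            where
            xw = proj₁ (split (adj x w) (adj w y) e)
            wy = proj₂ (split (adj x w) (adj w y) e)
            module Pr = Pair U sp x y w x≢y xw (adj-comm wy) ux uy

        module Simple (common≤1 : ∀ x y → x ≢ y → U x ≡ true → U y ≡ true → common x y ≤ 1) where

          simple-done : ∀ u → U u ≡ true → SparseDone U
          simple-done u uu = go (∑-pos (λ z → ⟦ adj u z ⟧ * two (d U z)) 1≤m)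
            where
            1≤m : 1 ≤ m U u
            1≤m = ≤-trans (m≤m+n 1 3) (≤-trans (degree-split sp uu) (≤-reflexive (cong (_+ m U u) (j≡0 u uu))))
            split : ∀ a k → 1 ≤ ⟦ a ⟧ * two k → a ≡ true × k ≡ 2
            split true 2 _ = refl , refl
            go : ∃[ w ] (1 ≤ ⟦ adj u w ⟧ * two (d U w)) → SparseDone U
            go (w , e) = go′ (second-white U uu dw)
              where
              uw = proj₁ (split (adj u w) (d U w) e)
              dw = proj₂ (split (adj u w) (d U w) e)
              go′ : ∃[ t ] (u ≢ t × adj t w ≡ true × U t ≡ true) → SparseDone U
              -- A survivor has at most two links here, so only `f 1` and `f 2` must be covered, and
              -- `f 2 = 350 + 2 * (119 + 76)`. The yield is `2 * (350 + 43 * 4) + 76 * 2 = 1196`.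
              go′ (t , u≢t , tw , ut) = Pr.pair-done 76 43 refl
                  (λ s us → growth-at-0 76 (proj₁ (∧-true {U s} us)) (small (Pr.k s) (k≤2 s us)))
                  1 (common-pos uw tw) (≤-trans (m≤m+n 1190 6) (+-monoˡ-≤ 152 (+-mono-≤ (worth 43 uu) (worth 43 ut))))
                where
                module Pr = Pair U sp u t w u≢t uw tw uu ut
                small : ∀ k → k ≤ 2 → f k ≤ 350 + (119 * k + 76 * k)
                small 0 _ = ≤-refl
                small 1 _ = m≤m+n 540 5
                small 2 _ = ≤-refl
                small (suc (suc (suc _))) (s≤s (s≤s ()))
                -- White vertices are independent, so `uw` removes only the white neighbours of `w`,
                -- and there are two of these.
                R⊆N : ∀ y → Pr.R y ≡ true → adj w y ∧ U y ≡ true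
                R⊆N y e = let (uy , c) = ∧-true {U y} e in true-∧ (cases y uy (y ≟ u) (y ≟ w) c) uy
                  where
                  cases : ∀ y → U y ≡ true → Dec (y ≡ u) → Dec (y ≡ w) → dom u w y ≡ true → adj w y ≡ true
                  cases y uy (yes refl) _ _ = adj-comm uw
                  cases y uy (no _) (yes refl) _ = true≢false uy (proj₁ sp u w uw uu)
                  cases y uy (no y≢u) (no y≢w) c rewrite ==-≢ y≢u | ==-≢ y≢w with adj u y in uy′
                  ... | false = c
                  ... | true = true≢false uy (proj₁ sp u y uy′ uu)
                k-common : ∀ s → Pr.k s ≡ ∑ (λ y → ⟦ Pr.R y ⟧ * common s y)
                k-common s =
                  trans (∑-cong λ z → sym (∑-* ⟦ adj s z ⟧ (λ y → ⟦ adj z y ∧ Pr.R y ⟧)))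
                  (trans (∑-swap (λ z y → ⟦ adj s z ⟧ * ⟦ adj z y ∧ Pr.R y ⟧))
                  (∑-cong λ y → trans (∑-cong λ z → swap (adj s z) (adj z y) (Pr.R y))
                    (∑-* ⟦ Pr.R y ⟧ (λ z → ⟦ adj s z ⟧ * ⟦ adj z y ⟧))))
                  where
                  swap : ∀ a b c → ⟦ a ⟧ * ⟦ b ∧ c ⟧ ≡ ⟦ c ⟧ * (⟦ a ⟧ * ⟦ b ⟧)
                  swap false b false = refl
                  swap false b true = refl
                  swap true false false = refl
                  swap true false true = refl
                  swap true true false = refl
                  swap true true true = refl
                -- The links from `s` to a removed `y` are their common neighbours, at most one for
                -- each of the two removed vertices.
                k≤2 : ∀ s → Pr.U' s ≡ true → Pr.k s ≤ 2
                k≤2 s us = ≤-trans (≤-reflexive (k-common s)) (≤-trans (∑-mono λ y → local y (true? (Pr.R y)))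
                  (≤-trans (#-mono {p = Pr.R} R⊆N) (≤-reflexive dw)))
                  where
                  local : ∀ y → Pr.R y ≡ true ⊎ Pr.R y ≡ false → ⟦ Pr.R y ⟧ * common s y ≤ ⟦ Pr.R y ⟧
                  local y (inj₂ e) = ≤-trans (≤-reflexive (cong (λ c → ⟦ c ⟧ * common s y) e)) z≤n
                  local y (inj₁ e) = ≤-trans (*-monoʳ-≤ ⟦ Pr.R y ⟧
                      (common≤1 s y s≢y (proj₁ (∧-true {U s} us)) (proj₁ (∧-true {U y} e))))
                    (≤-reflexive (*-identityʳ ⟦ Pr.R y ⟧))
                    where
                    s≢y : s ≢ y
                    s≢y refl = true≢false {not (dom u w s)} (proj₂ (∧-true {U s} us)) (cong not (proj₂ (∧-true {U s} e)))

        no-private-done : ∀ u → U u ≡ true → SparseDone U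
        no-private-done u uu = [ id , (λ none′ → Simple.simple-done (λ x y x≢y ux uy →
            ≤-pred (≰⇒> λ h → none′ x (y , x≢y , ux , uy , h))) u uu) ]′
          (search (λ x → any? λ y → ¬? (x ≟ y) ×-dec ((U x Bool.≟ true) ×-dec ((U y Bool.≟ true) ×-dec (2 ≤? common x y))))
            (λ x (y , x≢y , ux , uy , h) → parallel-done x y x≢y ux uy h))

      sparse-done : ∀ u → U u ≡ true → SparseDone U
      sparse-done u uu = [ id , (λ none′ → NoPrivate.no-private-done (λ s us →
          n<1⇒n≡0 (≰⇒> λ h → none′ s (us , h))) u uu) ]′
        (search (λ u → (U u Bool.≟ true) ×-dec (1 ≤? j U u)) private-done)

    -- Covering all vertices by few edges

    Edges : Set
    Edges = List (Fin n × Fin n)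

    record CoverOf (U : Fin n → Bool) (weight : ℕ) : Set where
      field
        edges  : Edges
        adjs   : All (λ (a , b) → adj a b ≡ true) edges
        covers : ∀ x → U x ≡ true → Any (λ (a , b) → dom a b x ≡ true) edges
        cheap  : length edges * 1190 ≤ weight

    add-edge : ∀ {U a b weight total} → adj a b ≡ true → CoverOf (U ∖ dom a b) weight →
               weight + 1190 ≤ total → CoverOf U total
    add-edge {U} {a} {b} {weight} ab c h = record
      { edges = (a , b) ∷ edges ; adjs = ab ∷ adjs
      ; covers = λ x ux → cover x ux (true? (dom a b x))
      ; cheap = ≤-trans (+-monoʳ-≤ 1190 cheap) (≤-trans (≤-reflexive (+-comm 1190 weight)) h) }
      where
      open CoverOf c
      cover : ∀ x → U x ≡ true → dom a b x ≡ true ⊎ dom a b x ≡ false → _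
      cover x ux (inj₁ e) = here e
      cover x ux (inj₂ e) = there (covers x (true-∧ ux (cong not e)))

    -- Sparseness persists under removal, so the second potential can be used to the end.
    sparse-shrink : ∀ {U} C → Sparse U → Sparse (U ∖ C)
    sparse-shrink {U} C sp =
      (λ x y xy ux → cong (_∧ not (C y)) (proj₁ sp x y xy (keep⊆ U C x ux))) ,
      λ z _ → ≤-trans (d-mono (keep⊆ U C) z) (d≤2 z (true? (U z)))
      where
      d≤2 : ∀ z → U z ≡ true ⊎ U z ≡ false → d U z ≤ 2
      d≤2 z (inj₁ uz) = ≤-trans (≤-reflexive (sparse-white sp uz)) z≤n
      d≤2 z (inj₂ uz) = proj₂ sp z uz

    smaller : ∀ {x y fuel} → x + 1190 ≤ y → y ≤ suc fuel → x ≤ fuel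
    smaller {x} h h′ = ≤-pred (≤-trans (s≤s (m≤m+n x 1189)) (≤-trans (≤-trans (≤-reflexive (sym (+-suc x 1189))) h) h′))

    -- The bound `fuel` makes the recursion structural; it suffices because every chosen edge lowers
    -- `Ψ` by at least 1190.
    sparse-cover : ∀ fuel U → Ψ U ≤ fuel → Sparse U → CoverOf U (Ψ U)
    sparse-cover fuel U h sp = [ step fuel h , stop ]′
        (search {A = SparseDone U} (λ x → U x Bool.≟ true) (SparseCases.sparse-done U sp))
      where
      stop : (∀ x → ¬ (U x ≡ true)) → CoverOf U (Ψ U)
      stop none′ = record { edges = [] ; adjs = [] ; covers = λ x ux → ⊥-elim (none′ x ux) ; cheap = z≤n }
      step : ∀ fuel → Ψ U ≤ fuel → SparseDone U → CoverOf U (Ψ U)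
      step zero h (a , b , ab , ua , drop) = ⊥-elim (1+n≰n (≤-trans (≤-trans (m≤n+m 1 _) drop′) h))
        where
        drop′ : Ψ (U ∖ dom a b) + 1 ≤ Ψ U
        drop′ = ≤-trans (+-monoʳ-≤ _ (m≤m+n 1 1189)) drop
      step (suc fuel) h (a , b , ab , ua , drop) =
        add-edge ab (sparse-cover fuel (U ∖ dom a b) (smaller drop h) (sparse-shrink (dom a b) sp)) drop

    -- On reaching the sparse phase the remaining edges are charged to `Ψ U`, which `Φ U` can afford
    -- by `Ψ≤Φ`.
    cover : ∀ fuel U → Φ U ≤ fuel → CoverOf U (Φ U)
    cover fuel U h = [ step fuel h , last ]′ (dense-or-sparse U)
      where
      last : Sparse U → CoverOf U (Φ U)
      last sp = record { edges = edges ; adjs = adjs ; covers = covers ; cheap = ≤-trans cheap (Ψ≤Φ U sp) }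
        where open CoverOf (sparse-cover (Ψ U) U ≤-refl sp)
      step : ∀ fuel → Φ U ≤ fuel → Done U → CoverOf U (Φ U)
      step zero h (a , b , ab , ub , drop) = ⊥-elim (1+n≰n (≤-trans (≤-trans (m≤n+m 1 _) drop′) h))
        where
        drop′ : Φ (U ∖ dom a b) + 1 ≤ Φ U
        drop′ = ≤-trans (+-monoʳ-≤ _ (m≤m+n 1 1189)) drop
      step (suc fuel) h (a , b , ab , ub , drop) = add-edge ab (cover fuel (U ∖ dom a b) (smaller drop h)) drop

    total-cover : CoverOf (λ _ → true) (n * 350)
    total-cover = subst (CoverOf _) (∑-const {n} 350) (cover (Φ (λ _ → true)) (λ _ → true) ≤-refl)

    -- From covering edges to a dominating set with a perfect matching

    record Matched (S : Fin n → Bool) : Set where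
      field
        partner : Fin n → Fin n
        inside  : ∀ v → S v ≡ true → S (partner v) ≡ true
        edge    : ∀ v → S v ≡ true → adj v (partner v) ≡ true
        invol   : ∀ v → S v ≡ true → partner (partner v) ≡ v

    Dominated : (Fin n → Bool) → Fin n → Set
    Dominated S x = S x ≡ true ⊎ ∃[ y ] (S y ≡ true × adj x y ≡ true)

    dominated-mono : ∀ {S S'} → (∀ x → S x ≡ true → S' x ≡ true) → ∀ {x} → Dominated S x → Dominated S' x
    dominated-mono S⊆ (inj₁ s) = inj₁ (S⊆ _ s)
    dominated-mono S⊆ (inj₂ (y , s , xy)) = inj₂ (y , S⊆ y s , xy)

    dominates-cov : ∀ {S a} → S a ≡ true → ∀ {x} → cov a x ≡ true → Dominated S x
    dominates-cov {S} {a} sa {x} c = cases (x ≟ a) c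
      where
      cases : Dec (x ≡ a) → cov a x ≡ true → Dominated S x
      cases (yes refl) _ = inj₁ sa
      cases (no x≢a) c rewrite ==-≢ x≢a = inj₂ (a , sa , adj-comm c)

    record Extension (S : Fin n → Bool) (P : (Fin n → Bool) → Set) : Set where
      field
        S'      : Fin n → Bool
        matched : Matched S'
        grows   : ∀ x → S x ≡ true → S' x ≡ true
        size    : # S' ≤ 2 + # S
        holds   : P S'

    insert : ∀ {S} → Matched S → ∀ v w → adj v w ≡ true → S v ≡ false → S w ≡ false →
             Extension S (λ S' → S' v ≡ true × S' w ≡ true)
    insert {S} M v w vw sv sw = record
      { S' = S' ; matched = record { partner = μ ; inside = λ x → inside′ x ; edge = edge′ ; invol = invol′ }
      ; grows = λ x s → ∨-introʳ {both v w x} s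
      ; size = ≤-trans (∑-mono bound) (≤-reflexive (trans (∑-+ {n} (λ x → ⟦ both v w x ⟧ * 1) (λ x → ⟦ S x ⟧))
                 (cong (_+ # S) (∑-both v≢w (λ _ → 1)))))
      ; holds = ∨-introˡ (∨-introˡ (==-refl v)) , ∨-introˡ (∨-introʳ {w == v} (==-refl w)) }
      where
      open Matched M
      v≢w : v ≢ w
      v≢w = adj⇒≢ vw
      S' : Fin n → Bool
      S' x = both v w x ∨ S x
      bound : ∀ x → ⟦ S' x ⟧ ≤ ⟦ both v w x ⟧ * 1 + ⟦ S x ⟧
      bound x with both v w x | S x
      ... | true | _ = s≤s z≤n
      ... | false | true = ≤-refl
      ... | false | false = z≤n
      μ : Fin n → Fin n
      μ x = if x == v then w else if x == w then v else partner x
      μv : μ v ≡ w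
      μv rewrite ==-refl v = refl
      μw : μ w ≡ v
      μw rewrite ==-≢ (v≢w ∘ sym) | ==-refl w = refl
      μ-old : ∀ {x} → x ≢ v → x ≢ w → μ x ≡ partner x
      μ-old x≢v x≢w rewrite ==-≢ x≢v | ==-≢ x≢w = refl
      old : ∀ {x} → x ≢ v → x ≢ w → S' x ≡ true → S x ≡ true
      old x≢v x≢w s rewrite ==-≢ x≢v | ==-≢ x≢w = s
      ≢-of : ∀ {x y} → S x ≡ true → S y ≡ false → x ≢ y
      ≢-of s s' refl = true≢false s s'
      S'v = ∨-introˡ {b = S v} (∨-introˡ {b = v == w} (==-refl v))
      S'w = ∨-introˡ {b = S w} (∨-introʳ {w == v} (==-refl w))
      inside′ : ∀ x → S' x ≡ true → S' (μ x) ≡ true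
      inside′ x s = cases (x ≟ v) (x ≟ w)
        where
        cases : Dec (x ≡ v) → Dec (x ≡ w) → S' (μ x) ≡ true
        cases (yes refl) _ = subst (λ y → S' y ≡ true) (sym μv) S'w
        cases (no _) (yes refl) = subst (λ y → S' y ≡ true) (sym μw) S'v
        cases (no p) (no q) = subst (λ y → S' y ≡ true) (sym (μ-old p q))
          (∨-introʳ {both v w (partner x)} (inside x (old p q s)))
      edge′ : ∀ x → S' x ≡ true → adj x (μ x) ≡ true
      edge′ x s = cases (x ≟ v) (x ≟ w)
        where
        cases : Dec (x ≡ v) → Dec (x ≡ w) → adj x (μ x) ≡ true
        cases (yes refl) _ = subst (λ y → adj x y ≡ true) (sym μv) vw
        cases (no _) (yes refl) = subst (λ y → adj x y ≡ true) (sym μw) (adj-comm vw)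
        cases (no p) (no q) = subst (λ y → adj x y ≡ true) (sym (μ-old p q)) (edge x (old p q s))
      invol′ : ∀ x → S' x ≡ true → μ (μ x) ≡ x
      invol′ x s = cases (x ≟ v) (x ≟ w)
        where
        cases : Dec (x ≡ v) → Dec (x ≡ w) → μ (μ x) ≡ x
        cases (yes refl) _ = trans (cong μ μv) μw
        cases (no _) (yes refl) = trans (cong μ μw) μv
        cases (no p) (no q) = trans (cong μ (μ-old p q))
          (trans (μ-old (≢-of in-S sv) (≢-of in-S sw)) (invol x (old p q s)))
          where in-S = inside x (old p q s)

    -- A vertex outside S is matched with a neighbour outside S; if it has none,
    -- then S already dominates its closed neighbourhood.
    absorb : ∀ {S} → Matched S → ∀ a b → adj a b ≡ true → S a ≡ true → S b ≡ false →
             Extension S (λ S' → ∀ x → dom a b x ≡ true → Dominated S' x)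
    absorb {S} M a b ab sa sb = [ id , stuck ]′
        (search (λ w → (adj b w Bool.≟ true) ×-dec (S w Bool.≟ false)) extend)
      where
      extend : ∀ w → adj b w ≡ true × S w ≡ false → Extension S (λ S' → ∀ x → dom a b x ≡ true → Dominated S' x)
      extend w (bw , sw) = record
        { S' = S' ; matched = matched ; grows = grows ; size = size
        ; holds = λ x e → cases x (true? (cov a x)) e }
        where
        open Extension (insert M b w bw sb sw)
        cases : ∀ x → cov a x ≡ true ⊎ cov a x ≡ false → dom a b x ≡ true → Dominated S' x
        cases x (inj₁ c) _ = dominates-cov (grows a sa) c
        cases x (inj₂ c) e rewrite c = dominates-cov (proj₁ holds) e
      stuck : (∀ w → ¬ (adj b w ≡ true × S w ≡ false)) → Extension S (λ S' → ∀ x → dom a b x ≡ true → Dominated S' x)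
      stuck none′ = record { S' = S ; matched = M ; grows = λ _ s → s ; size = m≤n+m _ 2
                           ; holds = λ x e → cases x (true? (cov a x)) e }
        where
        near : ∀ x → Dec (x ≡ b) → cov b x ≡ true → Dominated S x
        near x (yes refl) _ = inj₂ (a , sa , adj-comm ab)
        near x (no x≢b) c rewrite ==-≢ x≢b =
          inj₁ ([ id , (λ sx → ⊥-elim (none′ x (c , sx))) ]′ (true? (S x)))
        cases : ∀ x → cov a x ≡ true ⊎ cov a x ≡ false → dom a b x ≡ true → Dominated S x
        cases x (inj₁ c) _ = dominates-cov sa c
        cases x (inj₂ c) e rewrite c = near x (x ≟ b) e

    dom-comm : ∀ a b x → dom a b x ≡ true → dom b a x ≡ true
    dom-comm a b x e = trans (Bool.∨-comm (cov b x) (cov a x)) e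

    add : ∀ {S} → Matched S → ∀ a b → adj a b ≡ true →
          Extension S (λ S' → ∀ x → dom a b x ≡ true → Dominated S' x)
    add {S} M a b ab = cases (true? (S a)) (true? (S b))
      where
      from-both : ∀ {S'} → S' a ≡ true → S' b ≡ true → ∀ x → dom a b x ≡ true → Dominated S' x
      from-both sa sb x e = go (true? (cov a x)) e
        where
        go : cov a x ≡ true ⊎ cov a x ≡ false → dom a b x ≡ true → Dominated _ x
        go (inj₁ c) _ = dominates-cov sa c
        go (inj₂ c) e rewrite c = dominates-cov sb e
      cases : S a ≡ true ⊎ S a ≡ false → S b ≡ true ⊎ S b ≡ false →
              Extension S (λ S' → ∀ x → dom a b x ≡ true → Dominated S' x)
      cases (inj₁ sa) (inj₁ sb) = record
        { S' = S ; matched = M ; grows = λ _ s → s ; size = m≤n+m _ 2 ; holds = from-both sa sb }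
      cases (inj₁ sa) (inj₂ sb) = absorb M a b ab sa sb
      cases (inj₂ sa) (inj₁ sb) = record { Extension E ; holds = λ x e → Extension.holds E x (dom-comm a b x e) }
        where E = absorb M b a (adj-comm ab) sb sa
      cases (inj₂ sa) (inj₂ sb) = record { Extension E
          ; holds = from-both (proj₁ (Extension.holds E)) (proj₂ (Extension.holds E)) }
        where E = insert M a b ab sa sb

    record MatchedCover (es : Edges) : Set where
      field
        S         : Fin n → Bool
        matched   : Matched S
        size      : # S ≤ length es * 2
        dominates : ∀ x → Any (λ (a , b) → dom a b x ≡ true) es → Dominated S x

    matched-cover : ∀ {es} → All (λ (a , b) → adj a b ≡ true) es → MatchedCover es
    matched-cover [] = record
      { S = none
      ; matched = record { partner = id ; inside = λ _ () ; edge = λ _ () ; invol = λ _ () }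
      ; size = ≤-reflexive (∑-zero {n} λ _ → refl)
      ; dominates = λ _ () }
    matched-cover (_∷_ {x = a , b} ab abs) = record
      { S = S' ; matched = matched ; size = ≤-trans size (+-monoʳ-≤ 2 C.size)
      ; dominates = λ { x (here e) → holds x e ; x (there i) → dominated-mono grows (C.dominates x i) } }
      where
      module C = MatchedCover (matched-cover abs)
      open Extension (add C.matched a b ab)

    record Solution : Set where
      field
        S         : Fin n → Bool
        matched   : Matched S
        dominates : ∀ x → Dominated S x
        size      : # S * 17 ≤ n * 10

    abstract
      solution : Solution
      solution = record
        { S = S ; matched = matched ; dominates = λ x → dominates x (C.covers x refl)
        -- Here `1190 = 2 * 17 * 35` and `350 = 10 * 35`.
        ; size = *-cancelʳ-≤ (# S * 17) (n * 10) 35 (begin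
            # S * 17 * 35 ≤⟨ *-monoˡ-≤ 35 (*-monoˡ-≤ 17 size) ⟩
            length C.edges * 2 * 17 * 35 ≡⟨ trans (*-assoc (length C.edges * 2) 17 35) (*-assoc (length C.edges) 2 595) ⟩
            length C.edges * 1190 ≤⟨ C.cheap ⟩
            n * 350 ≡⟨ *-assoc n 10 35 ⟨
            n * 10 * 35 ∎) }
        where
        open ≤-Reasoning
        module C = CoverOf total-cover
        open MatchedCover (matched-cover C.adjs)

  -- Transfer to graphs, subsets and the paired domination number

  ∣tabulate∣ : ∀ {n} (q : Fin n → Bool) → ∣ tabulate q ∣ ≡ # q
  ∣tabulate∣ {zero} q = sym (∑-empty _)
  ∣tabulate∣ {suc n} q with q zero in e
  ... | true = trans (cong suc (∣tabulate∣ (q ∘ suc)))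
                 (sym (trans (∑-suc _) (cong (λ b → ⟦ b ⟧ + # (q ∘ suc)) e)))
  ... | false = trans (∣tabulate∣ (q ∘ suc))
                 (sym (trans (∑-suc _) (cong (λ b → ⟦ b ⟧ + # (q ∘ suc)) e)))

  minimum≤ : ∀ {n} (h : Fin (suc n) → ℕ) v → foldr₁ _⊓_ (tabulate h) ≤ h v
  minimum≤ {zero} h zero = ≤-refl
  minimum≤ {suc n} h zero = m⊓n≤m (h zero) _
  minimum≤ {suc n} h (suc v) = ≤-trans (m⊓n≤n (h zero) _) (minimum≤ (h ∘ suc) v)

  10/17-bound : ∀ γ n → γ * 17 ≤ n * 10 → γ * 17 ≤ 10 * n
  10/17-bound γ n h = ≤-trans h (≤-reflexive (*-comm n 10))

  5883/10000-bound : ∀ γ n .{{_ : NonZero n}} → γ * 17 ≤ n * 10 → γ * 10000 < 5883 * n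
  5883/10000-bound γ n h = *-cancelʳ-< 17 (γ * 10000) (5883 * n) (begin-strict
    γ * 10000 * 17 ≡⟨ trans (*-assoc γ 10000 17) (sym (*-assoc γ 17 10000)) ⟩
    γ * 17 * 10000 ≤⟨ *-monoˡ-≤ 10000 h ⟩
    n * 10 * 10000 ≡⟨ *-assoc n 10 10000 ⟩
    -- Strictness comes from `5883 * 17 = 100011` and the positive order.
    n * 100000 <⟨ *-monoʳ-< n (m≤m+n 100001 10) ⟩
    n * 100011 ≡⟨ *-assoc n 5883 17 ⟨
    n * 5883 * 17 ≡⟨ cong (_* 17) (*-comm n 5883) ⟩
    5883 * n * 17 ∎)
    where open ≤-Reasoning

  minDegree≤degree : ∀ {n} .{{_ : NonZero n}} (G : Graph (Fin n)) v → minDegree G ≤ degree G v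
  minDegree≤degree {suc n} G = minimum≤ (degree G)

  anyVec? : ∀ {k m} {P : Vec (Fin k) m → Set} → (∀ v → Dec (P v)) → Dec (∃ P)
  anyVec? {m = zero} P? = map′ ([] ,_) (λ { ([] , p) → p }) (P? [])
  anyVec? {m = suc m} P? = map′ (λ (x , v , p) → x ∷ v , p) (λ { (x ∷ v , p) → x , v , p })
    (any? λ x → anyVec? λ v → P? (x ∷ v))

  least : ∀ {Q : ℕ → Set} → (∀ k → Dec (Q k)) → ∀ k → Q k →
          ∃[ l ] (Q l × l ≤ k × (∀ i → Q i → l ≤ i))
  least {Q} Q? k qk = [ (λ (l , l<k , ql , min) → l , ql , <⇒≤ l<k , min)
                          , (λ none → k , qk , ≤-refl , λ i qi → ≮⇒≥ λ i<k → none i i<k qi) ]′ (below k)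
    where
    below : ∀ b → (∃[ l ] (l < b × Q l × (∀ i → Q i → l ≤ i))) ⊎ (∀ i → i < b → ¬ Q i)
    below zero = inj₂ λ _ ()
    below (suc b) = [ (λ (l , l<b , r) → inj₁ (l , m<n⇒m<1+n l<b , r)) , next ]′ (below b)
      where
      next : (∀ i → i < b → ¬ Q i) → _
      next none with Q? b
      ... | yes qb = inj₁ (b , ≤-refl , qb , λ i qi → ≮⇒≥ λ i<b → none i i<b qi)
      ... | no ¬qb = inj₂ λ i i<1+b qi → [ (λ i<b → none i i<b qi) , (λ { refl → ¬qb qi }) ]′ (m≤n⇒m<n∨m≡n (≤-pred i<1+b))

  module _ {n : ℕ} (G : Graph (Fin n)) where

    -- Paired domination with the matching given as a vector of partners: there are finitely many
    -- candidates, so existence is decidable and a least size can be found.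
    Pairing : Subset n → Vec (Fin n) n → Set
    Pairing S μ =
      (∀ v → v ∈ S → lookup μ v ∈ S × Adj G v (lookup μ v) × lookup μ (lookup μ v) ≡ v) ×
      (∀ v → v ∉ S → ∃[ u ] (u ∈ S × Adj G v u))

    matches : ∀ {S : Subset n} (μ : Vec (Fin n) n) {v w} → lookup μ v ≡ w → w ∈ S → Adj G v w → lookup μ w ≡ v →
              lookup μ v ∈ S × Adj G v (lookup μ v) × lookup μ (lookup μ v) ≡ v
    matches μ refl w∈S vw e = w∈S , vw , e

    Paired : Subset n → Set
    Paired S = ∃ (Pairing S)

    paired? : ∀ S → Dec (Paired S)
    paired? S = anyVec? λ μ →
      all? (λ v → (v ∈? S) →-dec ((lookup μ v ∈? S) ×-dec
        (Graph.adj? G v (lookup μ v) ×-dec (lookup μ (lookup μ v) ≟ v)))) ×-dec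
      all? (λ v → ¬? (v ∈? S) →-dec any? λ u → (u ∈? S) ×-dec Graph.adj? G v u)

    ∈-unique : ∀ {S : Subset n} {u v : ∃ (_∈ S)} → proj₁ u ≡ proj₁ v → u ≡ v
    ∈-unique {u = u , p} {.u , q} refl = cong (u ,_) ([]=-irrelevant p q)

    paired⇒dominating : ∀ {S} → Paired S → IsPairedDominating G S
    paired⇒dominating {S} (μ , match , dominates) = record
      { dominates = dominates
      ; matching = record
        { Matched  = λ u v → lookup μ (proj₁ u) ≡ proj₁ v
        ; sym      = λ { {u , p} {v , q} refl → proj₂ (proj₂ (match u p)) }
        ; edges    = λ { {u , p} {v , q} refl → proj₁ (proj₂ (match u p)) }
        ; saturate = λ { (v , p) → (lookup μ v , proj₁ (match v p)) , refl , ∈-unique } } }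

    -- Each vertex of `S` gets its unique mate. The mate of the mate is the vertex itself, by
    -- symmetry of the matching and uniqueness at the mate.
    dominating⇒paired : ∀ {S} → IsPairedDominating G S → Paired S
    dominating⇒paired {S} pd = tabulate partner , match , dominates
      where
      open IsPairedDominating pd
      open PerfectMatching matching renaming (sym to Matched-sym)
      choose : ∀ v → Dec (v ∈ S) → Fin n
      choose v (yes p) = proj₁ (proj₁ (saturate (v , p)))
      choose v (no _) = v
      partner : Fin n → Fin n
      partner v = choose v (v ∈? S)
      chosen : ∀ v (q : v ∈ S) → ∃[ w ] (partner v ≡ proj₁ w × Matched (v , q) w)
      chosen v q with v ∈? S
      ... | no v∉S = ⊥-elim (v∉S q)
      ... | yes p rewrite []=-irrelevant p q = proj₁ (saturate (v , q)) , refl , proj₁ (proj₂ (saturate (v , q)))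
      match : ∀ v → v ∈ S → lookup (tabulate partner) v ∈ S × Adj G v (lookup (tabulate partner) v) ×
              lookup (tabulate partner) (lookup (tabulate partner) v) ≡ v
      match v q = matches (tabulate partner) (trans (lookup∘tabulate partner v) v↦w) wS (edges M)
                    (trans (lookup∘tabulate partner w) (trans w↦x (cong proj₁ x≡v)))
        where
        w   = proj₁ (proj₁ (chosen v q))
        wS  = proj₂ (proj₁ (chosen v q))
        v↦w = proj₁ (proj₂ (chosen v q))
        M   = proj₂ (proj₂ (chosen v q))
        x   = proj₁ (chosen w wS)
        w↦x = proj₁ (proj₂ (chosen w wS))
        unique = proj₂ (proj₂ (saturate (w , wS)))
        x≡v : x ≡ (v , q)
        x≡v = trans (sym (unique (proj₂ (proj₂ (chosen w wS))))) (unique (Matched-sym M))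

    module _ (deg≥4 : ∀ v → 4 ≤ degree G v) where

      adjacent : Fin n → Fin n → Bool
      adjacent x y = does (Graph.adj? G x y)

      adjacent⇒Adj : ∀ {x y} → adjacent x y ≡ true → Adj G x y
      adjacent⇒Adj {x} {y} e with Graph.adj? G x y | e
      ... | yes a | _ = a
      ... | no _ | ()

      adjacent-sym : ∀ x y → adjacent x y ≡ adjacent y x
      adjacent-sym x y with Graph.adj? G x y
      ... | yes a = sym (dec-true (Graph.adj? G y x) (Graph.sym G a))
      ... | no ¬a = sym (dec-false (Graph.adj? G y x) (¬a ∘ Graph.sym G))

      adjacent-irrefl : ∀ x → adjacent x x ≡ false
      adjacent-irrefl x = dec-false (Graph.adj? G x x) (Graph.irrefl G refl)

      open Cover adjacent adjacent-sym adjacent-irrefl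
        (λ x → ≤-trans (deg≥4 x) (≤-reflexive (∣tabulate∣ (adjacent x))))
        using (Solution; solution; module Matched)

      small-paired : ∃[ S ] (Paired S × ∣ S ∣ * 17 ≤ n * 10)
      small-paired = tabulate S , (tabulate partner , match , dom) ,
                     ≤-trans (≤-reflexive (cong (_* 17) (∣tabulate∣ S))) size
        where
        open Solution solution
        open Matched matched
        ∈⇒ : ∀ {v} → v ∈ tabulate S → S v ≡ true
        ∈⇒ {v} p = trans (sym (lookup∘tabulate S v)) ([]=⇒lookup p)
        ⇒∈ : ∀ {v} → S v ≡ true → v ∈ tabulate S
        ⇒∈ {v} e = lookup⇒[]= v (tabulate S) (trans (lookup∘tabulate S v) e)
        match : ∀ v → v ∈ tabulate S → lookup (tabulate partner) v ∈ tabulate S ×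
                Adj G v (lookup (tabulate partner) v) ×
                lookup (tabulate partner) (lookup (tabulate partner) v) ≡ v
        match v p = matches (tabulate partner) (lookup∘tabulate partner v) (⇒∈ (inside v (∈⇒ p)))
          (adjacent⇒Adj (edge v (∈⇒ p))) (trans (lookup∘tabulate partner (partner v)) (invol v (∈⇒ p)))
        dom : ∀ v → v ∉ tabulate S → ∃[ u ] (u ∈ tabulate S × Adj G v u)
        dom v v∉S = [ (λ s → ⊥-elim (v∉S (⇒∈ s))) , (λ (u , s , a) → u , ⇒∈ s , adjacent⇒Adj a) ]′ (dominates v)

      domination-number : ∃[ γ ] (IsPairedDominationNumber G γ × γ * 17 ≤ n * 10)
      domination-number = conclude
        (least attained? ∣ proj₁ small-paired ∣ (proj₁ small-paired , proj₁ (proj₂ small-paired) , refl))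
        where
        Attained : ℕ → Set
        Attained k = ∃[ S ] (Paired S × ∣ S ∣ ≡ k)
        attained? : ∀ k → Dec (Attained k)
        attained? k = anySubset? λ S → paired? S ×-dec (∣ S ∣ ≟ℕ k)
        conclude : ∃[ γ ] (Attained γ × γ ≤ ∣ proj₁ small-paired ∣ × (∀ i → Attained i → γ ≤ i)) →
                   ∃[ γ ] (IsPairedDominationNumber G γ × γ * 17 ≤ n * 10)
        conclude (γ , (T , pT , e) , γ≤ , minimal) = γ
          , record { attained = T , paired⇒dominating pT , e
                   ; minimal = λ S pd → minimal ∣ S ∣ (S , dominating⇒paired pd , refl) }
          , ≤-trans (*-monoˡ-≤ 17 γ≤) (proj₂ (proj₂ small-paired))

  minDegree≥4⇒bound : ∀ {n} .{{_ : NonZero n}} (G : Graph (Fin n)) → 4 ≤ minDegree G →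
                      ∃[ γ ] (IsPairedDominationNumber G γ × γ * 17 ≤ n * 10)
  minDegree≥4⇒bound G δ≥4 = domination-number G λ v → ≤-trans δ≥4 (minDegree≤degree G v)

open import Data.Fin using (Fin)
open import Data.Integer using (+_)
open import Data.Nat using (ℕ; NonZero; _≥_)
open import Data.Product using (∃-syntax; _×_; _,_)
open import Data.Rational using (_/_; _*_; _≤_; _<_)

-- Rational inequalities from natural ones

module Fractions where
  open import Data.Integer as ℤ using ()
  import Data.Integer.Properties as ℤ
  open import Data.Nat as ℕ using (suc)
  import Data.Nat.Properties as ℕ
  open import Data.Rational using (toℚᵘ)
  open import Data.Rational.Properties
    using (toℚᵘ-cancel-≤; toℚᵘ-cancel-<; toℚᵘ-fromℚᵘ; toℚᵘ-homo-*)
  open import Data.Rational.Unnormalised as ℚᵘ using (mkℚᵘ; *≤*; *<*; _≃_)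
  import Data.Rational.Unnormalised.Properties as ℚᵘ
  open import Relation.Binary.PropositionalEquality using (_≡_; sym; cong; trans; subst₂)

  -- Unnormalised fractions multiply termwise, so comparing them amounts to cross-multiplication.
  product : ∀ a b n → toℚᵘ ((+ a / suc b) * (+ n / 1)) ≃ mkℚᵘ (+ a) b ℚᵘ.* mkℚᵘ (+ n) 0
  product a b n = ℚᵘ.≃-trans (toℚᵘ-homo-* (+ a / suc b) (+ n / 1))
    (ℚᵘ.*-cong (toℚᵘ-fromℚᵘ (mkℚᵘ (+ a) b)) (toℚᵘ-fromℚᵘ (mkℚᵘ (+ n) 0)))

  left : ∀ γ b → + (γ ℕ.* suc b) ≡ + γ ℤ.* + (suc b ℕ.* 1)
  left γ b = trans (ℤ.pos-* γ (suc b)) (cong (λ x → + γ ℤ.* + x) (sym (ℕ.*-identityʳ (suc b))))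

  right : ∀ a n → + (a ℕ.* n) ≡ (+ a ℤ.* + n) ℤ.* + 1
  right a n = trans (ℤ.pos-* a n) (sym (ℤ.*-identityʳ (+ a ℤ.* + n)))

  ≤-product : ∀ a b γ n → γ ℕ.* suc b ℕ.≤ a ℕ.* n → (+ γ / 1) ≤ (+ a / suc b) * (+ n / 1)
  ≤-product a b γ n h = toℚᵘ-cancel-≤
    (ℚᵘ.≤-respˡ-≃ (ℚᵘ.≃-sym (toℚᵘ-fromℚᵘ (mkℚᵘ (+ γ) 0)))
      (ℚᵘ.≤-respʳ-≃ (ℚᵘ.≃-sym (product a b n))
        (*≤* (subst₂ ℤ._≤_ (left γ b) (right a n) (ℤ.+≤+ h)))))

  <-product : ∀ a b γ n → γ ℕ.* suc b ℕ.< a ℕ.* n → (+ γ / 1) < (+ a / suc b) * (+ n / 1)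
  <-product a b γ n h = toℚᵘ-cancel-<
    (ℚᵘ.<-respˡ-≃ (ℚᵘ.≃-sym (toℚᵘ-fromℚᵘ (mkℚᵘ (+ γ) 0)))
      (ℚᵘ.<-respʳ-≃ (ℚᵘ.≃-sym (product a b n))
        (*<* (subst₂ ℤ._<_ (left γ b) (right a n) (ℤ.+<+ h)))))

theorem1 : ∀ (n : ℕ) .{{_ : NonZero n}} (G : Graph (Fin n)) →
    minDegree G ≥ 4 →
    ∃[ γ ] (IsPairedDominationNumber G γ ×
    (+ γ / 1) ≤ (+ 10 / 17) * (+ n / 1) ×
    (+ γ / 1) < (+ 5883 / 10000) * (+ n / 1))
theorem1 n G δ≥4 =
  let γ , isγ , γ*17≤n*10 = PairedDomination.minDegree≥4⇒bound G δ≥4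
  in γ , isγ ,
     Fractions.≤-product 10 16 γ n (PairedDomination.10/17-bound γ n γ*17≤n*10) ,
     Fractions.<-product 5883 9999 γ n (PairedDomination.5883/10000-bound γ n γ*17≤n*10)
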